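{- Let $k\geq 2$ and $n\geq 2k+1$ be integers, and let $C_n^k$ denote the circulant graph $Ci_n(1,2,\dots,k)$. Then \[ s(C_n^k)=\begin{cases}\left\lceil\frac{n+2k-1}{2k}\right\rceil+1, & \text{if } \big(n \bmod 4k = 2k+1 \text{ and } k \bmod 2=1\big) \text{ or } n=2k+1,\\[4pt] \left\lceil\frac{n+2k-1}{2k}\right\rceil, & \text{otherwise.}\end{cases} \]
   Context: For integers $n$ and $1\le k\le n/2$, the circulant graph $Ci_n(1,2,\dots,k)$ (the $k$-th power $C_n^k$ of the cycle $C_n$) is the simple graph with vertex set $\{0,1,\dots,n-1\}$ in which $x$ is adjacent to $x\pm i \pmod n$ for every $1\le i\le k$. For a simple graph $G$ with no isolated edges and at most one isolated vertex, an edge labelling $w:E(G)\to\{1,2,\dots,s\}$ assigns to each vertex $v$ the weighted degree $wd(v)=\sum_{e\ni v}w(e)$; the labelling is irregular if the weighted degrees of all vertices are pairwise distinct. The irregularity strength $s(G)$ is the smallest integer $s$ for which such an irregular edge labelling with labels in $\{1,\dots,s\}$ exists. -}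

module Defs where

open import Data.Nat using (ℕ; zero; suc; _+_; _*_; _∸_; _≤_; _<_)
open import Data.Nat.DivMod using (_/_; _%_; m%n<n)
open import Data.Fin using (Fin; toℕ; fromℕ<; _≟_)
import Data.Fin as F
open import Data.Bool using (Bool; true; false; _∨_; if_then_else_)
open import Relation.Nullary using (does)
open import Relation.Binary.PropositionalEquality using (_≡_)
open import Data.Product using (_×_; Σ)
open import Data.Sum using (_⊎_)
open import Function.Definitions using (Injective)

shift : ∀ {n} → Fin n → ℕ → Fin n
shift {suc m} x d = fromℕ< (m%n<n (toℕ x + d) (suc m))

sumFin : ∀ {n} → (Fin n → ℕ) → ℕ
sumFin {zero}  f = 0
sumFin {suc n} f = f F.zero + sumFin (λ i → f (F.suc i))

-- Edges of C_n^k = Ci_n(1,..,k) (for 2k < n) are indexed by pairs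
-- (x , i) : Fin n × Fin k, edge (x , i) being {x , x + (i+1) mod n};
-- for 1 ≤ i+1 ≤ k < n/2 this enumerates each edge exactly once.
-- An edge labelling is thus a function Fin n → Fin k → ℕ.
Labelling : ℕ → ℕ → Set
Labelling n k = Fin n → Fin k → ℕ

InRange : ∀ {n k} → ℕ → Labelling n k → Set
InRange {n} {k} s w = ∀ (x : Fin n) (i : Fin k) → 1 ≤ w x i × w x i ≤ s

incident : ∀ {n k} → Fin n → Fin n → Fin k → Bool
incident v x i = does (v ≟ x) ∨ does (v ≟ shift x (suc (toℕ i)))

wd : ∀ {n k} → Labelling n k → Fin n → ℕ
wd w v = sumFin (λ x → sumFin (λ i → if incident v x i then w x i else 0))

Irregular : ∀ {n k} → Labelling n k → Set
Irregular w = Injective _≡_ _≡_ (wd w)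

HasIrregularLabelling : ℕ → ℕ → ℕ → Set
HasIrregularLabelling n k s = Σ (Labelling n k) λ w → InRange s w × Irregular w

IrregularityStrength : ℕ → ℕ → ℕ → Set
IrregularityStrength n k s =
  HasIrregularLabelling n k s × (∀ t → HasIrregularLabelling n k t → s ≤ t)

-- ⌈ (n + 2k - 1) / (2k) ⌉ for k ≥ 1 (value for k = 0 irrelevant)
baseValue : ℕ → ℕ → ℕ
baseValue n zero = 0
baseValue n (suc j) = ((n + 2 * suc j ∸ 1) + (2 * suc j ∸ 1)) / (2 * suc j)

Exceptional : ℕ → ℕ → Set
Exceptional n zero = n ≡ 1
Exceptional n (suc j) =
  (n % (4 * suc j) ≡ 2 * suc j + 1 × suc j % 2 ≡ 1) ⊎ n ≡ 2 * suc j + 1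

{-# OPTIONS --safe #-}
module Submission where

-- Lower bound: n distinct weighted degrees lie in [2k , 2ks], so n ≤ 2k(s - 1) + 1.  If equality
-- holds, every value occurs; for s even and k odd their sum is then odd, while it counts each edge
-- twice, and for n = 2k + 1 there are two adjacent vertices whose labels are all 1 and all 2.
--
-- Upper bound: subtract 1 from all labels and use 0 on the edges that close the cycle up, so that
-- only a labelling of the k-th power of a path on N vertices remains.  Given one, put k vertices
-- before and k after it and add 1 to every edge except those inside the last k vertices.  The old
-- degrees grow by 2k, the first k vertices get k, …, 2k - 1 and the last k get k, …, 1: the single
-- collision disappears when the last k degrees drop by 1.  Doing this twice, the matching
-- between the two outer blocks of k lowers the degrees in both of them.  Hence N grows by 4k while
-- the largest label grows by 2, and only small starting configurations are needed: a single
-- vertex; for k even, 4k + 1 vertices corrected by a matching inside one block; and for the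
-- values of n that leave room, an antiregular (threshold) graph in the middle, whose only pair of
-- equal degrees is split by raising the k edges from one of its two vertices down to the block
-- before it.

open import Defs
open import Data.Bool using (Bool; true; false; if_then_else_)
open import Data.Fin as Fin using (Fin; toℕ; fromℕ<)
open import Data.Fin.Permutation using (permutation)
import Data.Fin.Properties as Fin
open import Data.Nat
open import Data.Nat.DivMod
open import Data.Nat.Divisibility using (n∣m*n)
open import Data.Nat.Properties
open import Data.Nat.Tactic.RingSolver using (solve-∀)
open import Data.Product using (_×_; _,_; proj₁; proj₂; ∃; ∃-syntax; Σ-syntax)
open import Data.Sum using (_⊎_; inj₁; inj₂; swap)
open import Function using (_∘_)
open import Function.Definitions using (Injective)
open import Relation.Binary.Definitions using (tri<; tri≈; tri>)
open import Relation.Binary.PropositionalEquality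
open import Relation.Nullary using (¬_; yes; no; does; contradiction)
open import Algebra.Properties.CommutativeMonoid.Sum +-0-commutativeMonoid
  using (sum; ∑-comm; ∑-distrib-+; sum-permute)

open ≡-Reasoning

-- Indicators and sums over initial segments of the natural numbers.

⟦_⟧ : Bool → ℕ
⟦ b ⟧ = if b then 1 else 0

<ᵇ-yes : ∀ {a b} → a < b → ⟦ a <ᵇ b ⟧ ≡ 1
<ᵇ-yes {zero}  {suc b} _         = refl
<ᵇ-yes {suc a} {suc b} (s≤s a<b) = <ᵇ-yes a<b

<ᵇ-no : ∀ {a b} → b ≤ a → ⟦ a <ᵇ b ⟧ ≡ 0
<ᵇ-no {a}     {zero}  _         = refl
<ᵇ-no {suc a} {suc b} (s≤s b≤a) = <ᵇ-no b≤a

≡ᵇ-refl : ∀ a → ⟦ a ≡ᵇ a ⟧ ≡ 1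
≡ᵇ-refl zero    = refl
≡ᵇ-refl (suc a) = ≡ᵇ-refl a

≡ᵇ-no : ∀ {a b} → a ≢ b → ⟦ a ≡ᵇ b ⟧ ≡ 0
≡ᵇ-no {zero}  {zero}  a≢b = contradiction refl a≢b
≡ᵇ-no {zero}  {suc b} _   = refl
≡ᵇ-no {suc a} {zero}  _   = refl
≡ᵇ-no {suc a} {suc b} a≢b = ≡ᵇ-no (a≢b ∘ cong suc)

≡ᵇ-+ˡ : ∀ x a b → ⟦ x + a ≡ᵇ x + b ⟧ ≡ ⟦ a ≡ᵇ b ⟧
≡ᵇ-+ˡ zero    a b = refl
≡ᵇ-+ˡ (suc x) a b = ≡ᵇ-+ˡ x a b

⟦⟧≤1 : ∀ b → ⟦ b ⟧ ≤ 1
⟦⟧≤1 false = z≤n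
⟦⟧≤1 true  = ≤-refl

∑ : ℕ → (ℕ → ℕ) → ℕ
∑ zero    f = 0
∑ (suc n) f = f 0 + ∑ n (f ∘ suc)

∑-cong : ∀ {f g} n → (∀ i → i < n → f i ≡ g i) → ∑ n f ≡ ∑ n g
∑-cong zero    eq = refl
∑-cong (suc n) eq = cong₂ _+_ (eq 0 z<s) (∑-cong n (λ i i<n → eq (suc i) (s≤s i<n)))

interchange : ∀ a b c d → (a + b) + (c + d) ≡ (a + c) + (b + d)
interchange = solve-∀

∑-+ : ∀ n f g → ∑ n (λ i → f i + g i) ≡ ∑ n f + ∑ n g
∑-+ zero    f g = refl
∑-+ (suc n) f g = trans (cong (f 0 + g 0 +_) (∑-+ n (f ∘ suc) (g ∘ suc)))
                        (interchange (f 0) (g 0) _ _)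

∑-const : ∀ n c → ∑ n (λ _ → c) ≡ n * c
∑-const zero    c = refl
∑-const (suc n) c = cong (c +_) (∑-const n c)

∑-zero : ∀ n → ∑ n (λ _ → 0) ≡ 0
∑-zero n = trans (∑-const n 0) (*-zeroʳ n)

∑-*ˡ : ∀ n c f → ∑ n (λ i → c * f i) ≡ c * ∑ n f
∑-*ˡ zero    c f = sym (*-zeroʳ c)
∑-*ˡ (suc n) c f = trans (cong (c * f 0 +_) (∑-*ˡ n c (f ∘ suc))) (sym (*-distribˡ-+ c _ _))

∑-<ᵇ : ∀ n {m} → m ≤ n → ∑ n (λ i → ⟦ i <ᵇ m ⟧) ≡ m
∑-<ᵇ n       {zero}  _         = ∑-zero n
∑-<ᵇ (suc n) {suc m} (s≤s m≤n) = cong suc (∑-<ᵇ n m≤n)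

∑-≡ᵇ : ∀ n {j} → j < n → ∑ n (λ i → ⟦ i ≡ᵇ j ⟧) ≡ 1
∑-≡ᵇ (suc n) {zero}  _         = cong suc (∑-zero n)
∑-≡ᵇ (suc n) {suc j} (s≤s j<n) = ∑-≡ᵇ n j<n

-- Edge labels on path powers: degrees, translations, matchings.

-- F x i is the label of the edge {x , x + i + 1} of a path power on ℕ.
EdgeFunction : Set
EdgeFunction = ℕ → ℕ → ℕ

infixl 6 _⊕_
_⊕_ : EdgeFunction → EdgeFunction → EdgeFunction
(F ⊕ G) x i = F x i + G x i

-- The labels of the edges {v - i - 1 , v} with i < k and i < v.
inSum : ℕ → EdgeFunction → ℕ → ℕ
inSum zero    F v       = 0
inSum (suc k) F zero    = 0
inSum (suc k) F (suc v) = F v 0 + inSum k (λ x i → F x (suc i)) v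

x<v : ∀ {v} x i → x + suc i ≡ v → x < v
x<v x i refl = m<m+n x z<s

-- The equation `x + suc i ≡ v` is passed on because many labels can be evaluated only once the
-- upper endpoint is known.
inSum-cong : ∀ k {F G} v → (∀ x i → i < k → x + suc i ≡ v → F x i ≡ G x i) →
             inSum k F v ≡ inSum k G v
inSum-cong zero    v       eq = refl
inSum-cong (suc k) zero    eq = refl
inSum-cong (suc k) (suc v) eq = cong₂ _+_ (eq v 0 z<s (+-comm v 1))
  (inSum-cong k v (λ x i i<k e → eq x (suc i) (s≤s i<k) (trans (+-suc x (suc i)) (cong suc e))))

inSum-⊕ : ∀ k F G v → inSum k (F ⊕ G) v ≡ inSum k F v + inSum k G v
inSum-⊕ zero    F G v       = refl
inSum-⊕ (suc k) F G zero    = refl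
inSum-⊕ (suc k) F G (suc v) =
  trans (cong (F v 0 + G v 0 +_) (inSum-⊕ k _ _ v)) (interchange (F v 0) (G v 0) _ _)

inSum-const : ∀ k c v → inSum k (λ _ _ → c) v ≡ c * (v ⊓ k)
inSum-const zero    c v       = sym (trans (cong (c *_) (⊓-zeroʳ v)) (*-zeroʳ c))
inSum-const (suc k) c zero    = sym (*-zeroʳ c)
inSum-const (suc k) c (suc v) = trans (cong (c +_) (inSum-const k c v)) (sym (*-suc c (v ⊓ k)))

inSum-zero : ∀ k v → inSum k (λ _ _ → 0) v ≡ 0
inSum-zero k v = inSum-const k 0 v

inSum-at-0 : ∀ k {F} → inSum k F 0 ≡ 0
inSum-at-0 zero    = refl
inSum-at-0 (suc k) = refl

inSum-suc : ∀ k {F G} v → (∀ i → F 0 i ≡ 0) → (∀ x i → F (suc x) i ≡ G x i) →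
            inSum k F (suc v) ≡ inSum k G v
inSum-suc zero    v       F0 FS = refl
inSum-suc (suc k) zero    F0 FS = cong₂ _+_ (F0 0) (inSum-at-0 k)
inSum-suc (suc k) (suc v) F0 FS =
  cong₂ _+_ (FS v 0) (inSum-suc k v (F0 ∘ suc) (λ x i → FS x (suc i)))

-- The factor kills the edges longer than `m`, which turns the `k`-th power of the path into the
-- `m`-th; the formulas for `below` can then be reused for `threshold`.
inSum-<ᵇʳ : ∀ k (F : EdgeFunction) {m} v → m ≤ k → inSum k (λ x i → F x i * ⟦ i <ᵇ m ⟧) v ≡ inSum m F v
inSum-<ᵇʳ k F {zero} v m≤k = trans (inSum-cong k v (λ x i _ _ → *-zeroʳ (F x i))) (inSum-zero k v)
inSum-<ᵇʳ (suc k) F {suc m} zero    m≤k       = refl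
inSum-<ᵇʳ (suc k) F {suc m} (suc v) (s≤s m≤k) =
  cong₂ _+_ (*-identityʳ (F v 0)) (inSum-<ᵇʳ k _ v m≤k)

inSum-≡ᵇʳ : ∀ k (F : EdgeFunction) {j} x → j < k → inSum k (λ x i → F x i * ⟦ i ≡ᵇ j ⟧) (x + suc j) ≡ F x j
inSum-≡ᵇʳ (suc k) F {j} x (s≤s j≤k) rewrite +-suc x j with j
... | zero  rewrite +-identityʳ x = trans (cong₂ _+_ (*-identityʳ (F x 0))
          (trans (inSum-cong k x (λ y i _ _ → *-zeroʳ (F y (suc i)))) (inSum-zero k x)))
        (+-identityʳ (F x 0))
... | suc j′ = cong₂ _+_ (*-zeroʳ (F (x + suc j′) 0)) (inSum-≡ᵇʳ k (λ x i → F x (suc i)) x j≤k)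

inSum-≡ᵇʳ-low : ∀ k (F : EdgeFunction) {j} v → v ≤ j → inSum k (λ x i → F x i * ⟦ i ≡ᵇ j ⟧) v ≡ 0
inSum-≡ᵇʳ-low k F {j} v v≤j = trans (inSum-cong k v zeros) (inSum-zero k v)
  where
  zeros : ∀ x i → i < k → x + suc i ≡ v → F x i * ⟦ i ≡ᵇ j ⟧ ≡ 0
  zeros x i _ e = trans (cong (F x i *_) (≡ᵇ-no i≢j)) (*-zeroʳ (F x i))
    where
    i≢j : i ≢ j
    i≢j refl = <⇒≱ (≤-trans (m≤n+m (suc i) x) (≤-reflexive e)) v≤j

-- On `c + k` vertices these are all edges except those inside the last `k` vertices, which is what
-- one layer of the construction adds.
below : ℕ → EdgeFunction
below c x i = ⟦ x <ᵇ c ⟧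

inSum-below-≤ : ∀ k {c} v → v ≤ c → inSum k (below c) v ≡ v ⊓ k
inSum-below-≤ k {c} v v≤c = begin
  inSum k (below c) v     ≡⟨ inSum-cong k v (λ x i _ e → <ᵇ-yes (≤-trans (x<v x i e) v≤c)) ⟩
  inSum k (λ _ _ → 1) v   ≡⟨ inSum-const k 1 v ⟩
  1 * (v ⊓ k)             ≡⟨ *-identityˡ _ ⟩
  v ⊓ k                   ∎

-- Going down from `c + u`, the nearest `u` lower endpoints are not below `c` and carry 0; the
-- minimum with `c` accounts for the start of the path.
inSum-below-≥ : ∀ k c u → inSum k (below c) (c + u) ≡ c ⊓ (k ∸ u)
inSum-below-≥ k c zero rewrite +-identityʳ c = inSum-below-≤ k c ≤-refl
inSum-below-≥ zero c (suc u) = sym (⊓-zeroʳ c)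
inSum-below-≥ (suc k) c (suc u) rewrite +-suc c u =
  cong₂ _+_ (<ᵇ-no (m≤m+n c u)) (inSum-below-≥ k c u)

delay : ℕ → EdgeFunction → EdgeFunction
delay zero    F x       i = F x i
delay (suc a) F zero    i = 0
delay (suc a) F (suc x) i = delay a F x i

delay-< : ∀ a F x i → x < a → delay a F x i ≡ 0
delay-< (suc a) F zero    i _         = refl
delay-< (suc a) F (suc x) i (s≤s x<a) = delay-< a F x i x<a

degree : ℕ → EdgeFunction → ℕ → ℕ
degree k F v = ∑ k (F v) + inSum k F v

degree-⊕ : ∀ k F G v → degree k (F ⊕ G) v ≡ degree k F v + degree k G v
degree-⊕ k F G v = trans (cong₂ _+_ (∑-+ k (F v) (G v)) (inSum-⊕ k F G v))
                         (interchange (∑ k (F v)) _ _ _)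

degree-cong : ∀ k {F G} v → (∀ x i → i < k → F x i ≡ G x i) → degree k F v ≡ degree k G v
degree-cong k v eq = cong₂ _+_ (∑-cong k (eq v)) (inSum-cong k v (λ x i i<k _ → eq x i i<k))

degree-zero : ∀ k v → degree k (λ _ _ → 0) v ≡ 0
degree-zero k v = cong₂ _+_ (∑-zero k) (inSum-zero k v)

degree-delay-< : ∀ k a F v → v < a → degree k (delay a F) v ≡ 0
degree-delay-< k a F v v<a = cong₂ _+_
  (trans (∑-cong k (λ i _ → delay-< a F v i v<a)) (∑-zero k))
  (trans (inSum-cong k v (λ x i _ e → delay-< a F x i (<-trans (x<v x i e) v<a))) (inSum-zero k v))

degree-delay-+ : ∀ k a F v → degree k (delay a F) (a + v) ≡ degree k F v
degree-delay-+ k zero    F v = refl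
degree-delay-+ k (suc a) F v = trans
  (cong (∑ k (delay a F (a + v)) +_) (inSum-suc k (a + v) (λ _ → refl) (λ _ _ → refl)))
  (degree-delay-+ k a F v)

≤ᵇ-yes : ∀ {a b} → a ≤ b → ⟦ a ≤ᵇ b ⟧ ≡ 1
≤ᵇ-yes {zero}  _   = refl
≤ᵇ-yes {suc a} a<b = <ᵇ-yes a<b

≤ᵇ-no : ∀ {a b} → b < a → ⟦ a ≤ᵇ b ⟧ ≡ 0
≤ᵇ-no {suc a} (s≤s b≤a) = <ᵇ-no b≤a

degree-delay-≥ : ∀ k a F {v} → a ≤ v → degree k (delay a F) v ≡ degree k F (v ∸ a)
degree-delay-≥ k a F {v} a≤v =
  trans (cong (degree k (delay a F)) (sym (m+[n∸m]≡n a≤v))) (degree-delay-+ k a F (v ∸ a))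

-- The perfect matching of the first `m + m` vertices that joins `x` to `x + m`; index `i` stands
-- for length `suc i`.
matching : ℕ → EdgeFunction
matching m x i = ⟦ x <ᵇ m ⟧ * ⟦ suc i ≡ᵇ m ⟧

matching-out : ∀ {k m} v → 1 ≤ m → m ≤ k → ∑ k (matching m v) ≡ ⟦ v <ᵇ m ⟧
matching-out {k} {suc j} v _ j<k = begin
  ∑ k (λ i → ⟦ v <ᵇ suc j ⟧ * ⟦ i ≡ᵇ j ⟧)   ≡⟨ ∑-*ˡ k ⟦ v <ᵇ suc j ⟧ _ ⟩
  ⟦ v <ᵇ suc j ⟧ * ∑ k (λ i → ⟦ i ≡ᵇ j ⟧)   ≡⟨ cong (⟦ v <ᵇ suc j ⟧ *_) (∑-≡ᵇ k j<k) ⟩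
  ⟦ v <ᵇ suc j ⟧ * 1                        ≡⟨ *-identityʳ _ ⟩
  ⟦ v <ᵇ suc j ⟧                            ∎

-- A vertex below `m` has only its upward edge, since an edge of length `m` ending there would start
-- before 0; a later vertex has only the edge from `v ∸ m`.
degree-matching-< : ∀ {k m v} → 1 ≤ m → m ≤ k → v < m + m → degree k (matching m) v ≡ 1
degree-matching-< {k} {m@(suc j)} {v} 1≤m m≤k v<m+m
  rewrite matching-out {k} v 1≤m m≤k with v <? m
... | yes v<m = cong₂ _+_ (<ᵇ-yes v<m) (inSum-≡ᵇʳ-low k (below m) v (≤-pred v<m))
... | no  v≮m = cong₂ _+_ (<ᵇ-no m≤v)
        (trans (cong (inSum k (matching m)) (sym (m∸n+n≡m m≤v)))
        (trans (inSum-≡ᵇʳ k (below m) (v ∸ m) m≤k)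
               (<ᵇ-yes (+-cancelʳ-< m (v ∸ m) m (subst (_< m + m) (sym (m∸n+n≡m m≤v)) v<m+m)))))
  where m≤v = ≮⇒≥ v≮m

degree-matching-≥ : ∀ {k m v} → 1 ≤ m → m ≤ k → m + m ≤ v → degree k (matching m) v ≡ 0
degree-matching-≥ {k} {m@(suc j)} {v} 1≤m m≤k m+m≤v
  rewrite matching-out {k} v 1≤m m≤k =
  cong₂ _+_ (<ᵇ-no m≤v)
    (trans (cong (inSum k (matching m)) (sym (m∸n+n≡m m≤v)))
    (trans (inSum-≡ᵇʳ k (below m) (v ∸ m) m≤k)
           (<ᵇ-no (+-cancelʳ-≤ m m (v ∸ m) (subst (m + m ≤_) (sym (m∸n+n≡m m≤v)) m+m≤v)))))
  where m≤v = ≤-trans (m≤m+n m m) m+m≤v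

-- Makes the subtraction of a translated matching from a layer of ones exact: all its lower
-- endpoints precede `a + m`.
delay-matching≤below : ∀ a m x i → delay a (matching m) x i ≤ below (a + m) x i
delay-matching≤below zero    m x       i =
  ≤-trans (*-monoʳ-≤ ⟦ x <ᵇ m ⟧ (⟦⟧≤1 (suc i ≡ᵇ m))) (≤-reflexive (*-identityʳ _))
delay-matching≤below (suc a) m zero    i = z≤n
delay-matching≤below (suc a) m (suc x) i = delay-matching≤below a m x i

below-mono : ∀ {a b} → a ≤ b → ∀ x i → below a x i ≤ below b x i
below-mono {a} {b} a≤b x i with x <? a
... | yes x<a = ≤-reflexive (trans (<ᵇ-yes x<a) (sym (<ᵇ-yes (≤-trans x<a a≤b))))
... | no  x≮a = ≤-trans (≤-reflexive (<ᵇ-no (≮⇒≥ x≮a))) z≤n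

-- Realisable degree sequences and their correction by subtraction.

Bounded : ℕ → ℕ → EdgeFunction → Set
Bounded k s F = ∀ x i → i < k → F x i ≤ s

-- The edges with `N ≤ x + suc i` leave the path; on the cycle they are the ones that close it up.
Supported : ℕ → ℕ → EdgeFunction → Set
Supported k N F = ∀ x i → i < k → N ≤ x + suc i → F x i ≡ 0

InjectiveBelow : ℕ → (ℕ → ℕ) → Set
InjectiveBelow N d = ∀ u v → u < N → v < N → d u ≡ d v → u ≡ v

IsRealisation : ℕ → ℕ → ℕ → (ℕ → ℕ) → EdgeFunction → Set
IsRealisation k s N d F =
  Bounded k s F × Supported k N F × (∀ v → v < N → degree k F v ≡ d v)

Realisable : ℕ → ℕ → ℕ → (ℕ → ℕ) → Set
Realisable k s N d = ∃ (IsRealisation k s N d)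

IrregularPath : ℕ → ℕ → ℕ → Set
IrregularPath k s N = ∃[ d ] Realisable k s N d × InjectiveBelow N d

-- The degrees become distinct once the last k of them are lowered by 1.
AlmostIrregularPath : ℕ → ℕ → ℕ → Set
AlmostIrregularPath k s N =
  ∃[ d ] Realisable k s (N + k) (λ v → d v + ⟦ N ≤ᵇ v ⟧) × InjectiveBelow (N + k) d

degree-supported : ∀ {k N F} → Supported k N F → ∀ v → N ≤ v → degree k F v ≡ 0
degree-supported {k} {N} {F} supp v N≤v = cong₂ _+_
  (trans (∑-cong k (λ i i<k → supp v i i<k (≤-trans N≤v (m≤m+n v (suc i))))) (∑-zero k))
  (trans (inSum-cong k v (λ x i i<k e → supp x i i<k (≤-trans N≤v (≤-reflexive (sym e)))))
         (inSum-zero k v))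

-- Truncated subtraction is exact because `M` lies pointwise below `F`, so degrees subtract too.
subtract : ∀ {k s N d d′ F} M → IsRealisation k s N d F →
           (∀ x i → i < k → M x i ≤ F x i) →
           (∀ v → v < N → d v ≡ d′ v + degree k M v) → Realisable k s N d′
subtract {k} {s} {N} {d} {d′} {F} M (bound , supp , deg) M≤F d≡ =
  F⊖M , (λ x i i<k → ≤-trans (m∸n≤m (F x i) (M x i)) (bound x i i<k))
      , (λ x i i<k N≤ → trans (cong (_∸ M x i) (supp x i i<k N≤)) (0∸n≡0 (M x i)))
      , deg′
  where
  F⊖M : EdgeFunction
  F⊖M x i = F x i ∸ M x i
  deg′ : ∀ v → v < N → degree k F⊖M v ≡ d′ v
  deg′ v v<N = +-cancelʳ-≡ (degree k M v) _ _ (begin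
    degree k F⊖M v + degree k M v   ≡⟨ degree-⊕ k F⊖M M v ⟨
    degree k (F⊖M ⊕ M) v            ≡⟨ degree-cong k v (λ x i i<k → m∸n+n≡m (M≤F x i i<k)) ⟩
    degree k F v                    ≡⟨ deg v v<N ⟩
    d v                             ≡⟨ d≡ v v<N ⟩
    d′ v + degree k M v             ∎)

-- Surrounding a path power by two blocks of `k` vertices.

data Layer (k N : ℕ) : ℕ → Set where
  low  : ∀ {v} → v < k → Layer k N v
  mid  : ∀ u → u < N → Layer k N (k + u)
  high : ∀ u → u < k → Layer k N (k + N + u)

layer : ∀ k N v → v < k + N + k → Layer k N v
layer k N v v< with v <? k
... | yes v<k = low v<k
... | no  v≮k with v <? k + N
...   | yes v<k+N = subst (Layer k N) (m+[n∸m]≡n k≤v)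
          (mid (v ∸ k) (+-cancelˡ-< k _ _ (subst (_< k + N) (sym (m+[n∸m]≡n k≤v)) v<k+N)))
        where k≤v = ≮⇒≥ v≮k
...   | no  v≮k+N = subst (Layer k N) (m+[n∸m]≡n k+N≤v)
          (high (v ∸ (k + N))
            (+-cancelˡ-< (k + N) _ _ (subst (_< k + N + k) (sym (m+[n∸m]≡n k+N≤v)) v<)))
        where k+N≤v = ≮⇒≥ v≮k+N

-- The degrees d of N vertices, raised by 2k and surrounded by k, …, 2k - 1 and k - 1, …, 0.
onion : ℕ → ℕ → (ℕ → ℕ) → ℕ → ℕ
onion k N d v =
  if v <ᵇ k then k + v else if v <ᵇ k + N then k + k + d (v ∸ k) else k ∸ suc (v ∸ (k + N))

<ᵇ-true : ∀ {a b} → a < b → (a <ᵇ b) ≡ true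
<ᵇ-true {zero}  {suc b} _         = refl
<ᵇ-true {suc a} {suc b} (s≤s a<b) = <ᵇ-true a<b

<ᵇ-false : ∀ {a b} → b ≤ a → (a <ᵇ b) ≡ false
<ᵇ-false {a}     {zero}  _         = refl
<ᵇ-false {suc a} {suc b} (s≤s b≤a) = <ᵇ-false b≤a

onion-low : ∀ k N d {v} → v < k → onion k N d v ≡ k + v
onion-low k N d v<k rewrite <ᵇ-true v<k = refl

onion-mid : ∀ k N d {u} → u < N → onion k N d (k + u) ≡ k + k + d u
onion-mid k N d {u} u<N
  rewrite <ᵇ-false (m≤m+n k u) | <ᵇ-true (+-monoʳ-< k u<N) | m+n∸m≡n k u = refl

onion-high : ∀ k N d u → onion k N d (k + N + u) ≡ k ∸ suc u
onion-high k N d u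
  rewrite <ᵇ-false (≤-trans (m≤m+n k N) (m≤m+n (k + N) u)) | <ᵇ-false (m≤m+n (k + N) u)
        | m+n∸m≡n (k + N) u = refl

k∸suc<k : ∀ {k u} → u < k → k ∸ suc u < k
k∸suc<k {suc k} {u} _ = s≤s (m∸n≤m k u)

∸≡suc∸suc : ∀ {k u} → u < k → k ∸ u ≡ suc (k ∸ suc u)
∸≡suc∸suc {suc k} (s≤s u≤k) = +-∸-assoc 1 u≤k

-- The first, middle and last blocks take values in the disjoint ranges `[k , 2k)`, `[2k , ∞)` and
-- `[0 , k)`, and within each block the values differ.
onion-injective : ∀ k N d → InjectiveBelow N d → InjectiveBelow (k + N + k) (onion k N d)
onion-injective k N d inj u v u< v< = go (layer k N u u<) (layer k N v v<)
  where
  go : ∀ {u v} → Layer k N u → Layer k N v → onion k N d u ≡ onion k N d v → u ≡ v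
  go (low p) (low q) e rewrite onion-low k N d p | onion-low k N d q = +-cancelˡ-≡ k _ _ e
  go (mid a p) (mid b q) e rewrite onion-mid k N d p | onion-mid k N d q =
    cong (k +_) (inj a b p q (+-cancelˡ-≡ (k + k) _ _ e))
  go (high a p) (high b q) e rewrite onion-high k N d a | onion-high k N d b =
    cong (k + N +_) (suc-injective (∸-cancelˡ-≡ p q e))
  go (low p) (mid b q) e rewrite onion-low k N d p | onion-mid k N d q =
    contradiction e (<⇒≢ (≤-trans (+-monoʳ-< k p) (m≤m+n (k + k) (d b))))
  go (mid a p) (low q) e = sym (go (low q) (mid a p) (sym e))
  go (high a p) (low {v} q) e rewrite onion-high k N d a | onion-low k N d q =
    contradiction e (<⇒≢ (≤-trans (k∸suc<k p) (m≤m+n k v)))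
  go (low p) (high b q) e = sym (go (high b q) (low p) (sym e))
  go (high a p) (mid b q) e rewrite onion-high k N d a | onion-mid k N d q =
    contradiction e (<⇒≢ (≤-trans (k∸suc<k p) (≤-trans (m≤m+n k k) (m≤m+n (k + k) (d b)))))
  go (mid a p) (high b q) e = sym (go (high b q) (mid a p) (sym e))

wrap : ℕ → ℕ → EdgeFunction → EdgeFunction
wrap k N F = below (k + N) ⊕ delay k F

degree-below : ∀ k c v → degree k (below c) v ≡ k * ⟦ v <ᵇ c ⟧ + inSum k (below c) v
degree-below k c v = cong (_+ inSum k (below c) v) (∑-const k ⟦ v <ᵇ c ⟧)

-- A vertex `v` of the first block has `k` new edges up and `v` down, a middle vertex has `2k` new
-- edges, and vertex `u` of the last block receives from the `k ∸ u` lower endpoints before that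
-- block. This exceeds the wanted `k ∸ suc u` by 1, whence the surplus term.
wrap-realises : ∀ {k s N d F} → IsRealisation k s N d F →
  IsRealisation k (suc s) (k + N + k) (λ v → onion k N d v + ⟦ k + N ≤ᵇ v ⟧) (wrap k N F)
wrap-realises {k} {s} {N} {d} {F} (bound , supp , deg) =
  bound′ , supp′ , λ v v< → trans (degree-⊕ k (below (k + N)) (delay k F) v) (deg′ (layer k N v v<))
  where
  delay-bound : ∀ a x i → i < k → delay a F x i ≤ s
  delay-bound zero    x       i i<k = bound x i i<k
  delay-bound (suc a) zero    i i<k = z≤n
  delay-bound (suc a) (suc x) i i<k = delay-bound a x i i<k

  bound′ : Bounded k (suc s) (wrap k N F)
  bound′ x i i<k = +-mono-≤ (⟦⟧≤1 (x <ᵇ k + N)) (delay-bound k x i i<k)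

  delay-supp : ∀ a x i → i < k → a + N ≤ x + suc i → delay a F x i ≡ 0
  delay-supp zero    x       i i<k le       = supp x i i<k le
  delay-supp (suc a) zero    i i<k le       = refl
  delay-supp (suc a) (suc x) i i<k (s≤s le) = delay-supp a x i i<k le

  supp′ : Supported k (k + N + k) (wrap k N F)
  supp′ x i i<k le = cong₂ _+_
    (<ᵇ-no (+-cancelʳ-≤ k (k + N) x (≤-trans le (+-monoʳ-≤ x i<k))))
    (delay-supp k x i i<k (≤-trans (m≤m+n (k + N) k) le))

  deg′ : ∀ {v} → Layer k N v → degree k (below (k + N)) v + degree k (delay k F) v
         ≡ onion k N d v + ⟦ k + N ≤ᵇ v ⟧
  deg′ {v} (low p)
    rewrite onion-low k N d p | degree-below k (k + N) v | degree-delay-< k k F v p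
          | <ᵇ-yes (≤-trans p (m≤m+n k N)) | ≤ᵇ-no {k + N} (≤-trans p (m≤m+n k N))
          | inSum-below-≤ k v (≤-trans (<⇒≤ p) (m≤m+n k N)) | m≤n⇒m⊓n≡m (<⇒≤ p)
          | *-identityʳ k = refl
  deg′ (mid u p)
    rewrite onion-mid k N d p | degree-below k (k + N) (k + u) | degree-delay-+ k k F u
          | deg u p | <ᵇ-yes (+-monoʳ-< k p) | ≤ᵇ-no {k + N} (+-monoʳ-< k p)
          | inSum-below-≤ k (k + u) (+-monoʳ-≤ k (<⇒≤ p)) | m≥n⇒m⊓n≡n (m≤m+n k u)
          | *-identityʳ k = sym (+-identityʳ _)
  deg′ (high u p)
    rewrite onion-high k N d u | degree-below k (k + N) (k + N + u)
          | +-assoc k N u | degree-delay-+ k k F (N + u) | sym (+-assoc k N u)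
          | degree-supported supp (N + u) (m≤m+n N u)
          | <ᵇ-no (m≤m+n (k + N) u) | ≤ᵇ-yes (m≤m+n (k + N) u)
          | inSum-below-≥ k (k + N) u | m≥n⇒m⊓n≡n (≤-trans (m∸n≤m k u) (m≤m+n k N))
          | *-zeroʳ k | +-identityʳ (k ∸ u) = trans (∸≡suc∸suc p) (sym (+-comm (k ∸ suc u) 1))

wrap-irregular : ∀ {k s N} → IrregularPath k s N → AlmostIrregularPath k (suc s) (k + N)
wrap-irregular {k} {s} {N} (d , (F , F-real) , inj) =
  onion k N d , (_ , wrap-realises F-real) , onion-injective k N d inj

-- The matching of length `k` starting at `k + N` pairs the last inner block with the new last
-- block, so one subtraction removes both the old surplus and the new one.
wrap-almostIrregular : ∀ {k s N} → 1 ≤ k → AlmostIrregularPath k s N → IrregularPath k (suc s) (k + (N + k) + k)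
wrap-almostIrregular {k} {s} {N} 1≤k (d , (F , F-real) , inj) =
  onion k (N + k) d , subtract (delay (k + N) (matching k)) (wrap-realises F-real) M≤W
    (λ v v< → deg′ (layer k (N + k) v v<)) , onion-injective k (N + k) d inj
  where
  -- The lower endpoints of the matching are inner vertices, where the new layer has label 1.
  M≤W : ∀ x i → i < k → delay (k + N) (matching k) x i ≤ wrap k (N + k) F x i
  M≤W x i _ = ≤-trans (delay-matching≤below (k + N) k x i)
    (≤-trans (below-mono (≤-reflexive (+-assoc k N k)) x i) (m≤m+n _ _))

  d⁺ : ℕ → ℕ
  d⁺ v = d v + ⟦ N ≤ᵇ v ⟧

  deg′ : ∀ {v} → Layer k (N + k) v → onion k (N + k) d⁺ v + ⟦ k + (N + k) ≤ᵇ v ⟧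
         ≡ onion k (N + k) d v + degree k (delay (k + N) (matching k)) v
  deg′ {v} (low p)
    rewrite onion-low k (N + k) d p | onion-low k (N + k) d⁺ p
          | degree-delay-< k (k + N) (matching k) v (≤-trans p (m≤m+n k N))
          | ≤ᵇ-no {k + (N + k)} (≤-trans p (m≤m+n k (N + k))) = refl
  deg′ (mid u p)
    rewrite onion-mid k (N + k) d p | onion-mid k (N + k) d⁺ p
          | ≤ᵇ-no {k + (N + k)} (+-monoʳ-< k p)
          | +-identityʳ (k + k + d⁺ u) | sym (+-assoc (k + k) (d u) ⟦ N ≤ᵇ u ⟧) with u <? N
  ... | yes u<N rewrite ≤ᵇ-no {N} u<N
          | degree-delay-< k (k + N) (matching k) (k + u) (+-monoʳ-< k u<N) = refl
  -- The last `k` inner vertices are the lower ends of the matching, which accounts for their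
  -- surplus.
  ... | no u≮N
    rewrite ≤ᵇ-yes (≮⇒≥ u≮N)
          | degree-delay-≥ k (k + N) (matching k) (+-monoʳ-≤ k (≮⇒≥ u≮N))
          | [m+n]∸[m+o]≡n∸o k u N
          | degree-matching-< 1≤k ≤-refl
              (≤-trans (s≤s (m≤n+o⇒m∸n≤o u N (<⇒≤ p))) (m<m+n k 1≤k)) = refl
  deg′ (high u p)
    rewrite onion-high k (N + k) d u | onion-high k (N + k) d⁺ u
          | ≤ᵇ-yes (m≤m+n (k + (N + k)) u)
          | trans (cong (_+ u) (sym (+-assoc k N k))) (+-assoc (k + N) k u)
          | degree-delay-+ k (k + N) (matching k) (k + u)
          | degree-matching-< 1≤k ≤-refl (+-monoʳ-< k p) = refl

irregular-step : ∀ {k s N} → 1 ≤ k → IrregularPath k s N → IrregularPath k (2 + s) (k + (k + N + k) + k)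
irregular-step 1≤k g = wrap-almostIrregular 1≤k (wrap-irregular g)

irregular-iterate : ∀ {k s N} → 1 ≤ k → IrregularPath k s N → ∀ j → IrregularPath k (j * 2 + s) (j * (4 * k) + N)
irregular-iterate {k} {s} {N} 1≤k g zero    = g
irregular-iterate {k} {s} {N} 1≤k g (suc j) =
  subst (IrregularPath k (2 + (j * 2 + s))) (eq k (j * (4 * k)) N) (irregular-step 1≤k (irregular-iterate 1≤k g j))
  where
  eq : ∀ k a N → k + (k + (a + N) + k) + k ≡ 4 * k + a + N
  eq = solve-∀

-- Starting configurations: a single vertex, and even `k`.

irregular-one : ∀ k → IrregularPath k 0 1
irregular-one k = (λ _ → 0) , ((λ _ _ → 0) , (λ _ _ _ → z≤n) , (λ _ _ _ _ → refl) , λ v _ → degree-zero k v)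
           , λ { zero zero _ _ _ → refl ; (suc _) _ (s≤s ()) ; zero (suc _) _ (s≤s ()) }

-- Wrapping a single vertex twice leaves a surplus on the last block of each layer. As `k` is even,
-- the inner block can be matched within itself by edges of length `m`; the outer surplus stays, as
-- an almost irregular path requires.
almostIrregularPath-even : ∀ {m} → 1 ≤ m → let k = m + m in AlmostIrregularPath k 2 (k + (k + 1 + k))
almostIrregularPath-even {m} 1≤m = onion k N d
  , subtract (delay (k + (k + 1)) (matching m)) (wrap-realises W₁-real) M≤W
      (λ v v< → deg′ (layer k N v v<))
  , onion-injective k N d (onion-injective k 1 (λ _ → 0) (proj₂ (proj₂ (irregular-one k))))
  where
  k N : ℕ
  k = m + m
  N = k + 1 + k
  d d⁺ : ℕ → ℕ
  d = onion k 1 (λ _ → 0)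
  d⁺ v = d v + ⟦ k + 1 ≤ᵇ v ⟧
  -- After the second wrapping the last block of the first layer starts at `k + (k + 1)`.
  M = delay (k + (k + 1)) (matching m)

  W₁-real : IsRealisation k 1 N d⁺ (wrap k 1 (λ _ _ → 0))
  W₁-real = wrap-realises (proj₂ (proj₁ (proj₂ (irregular-one k))))

  M≤W : ∀ x i → i < k → M x i ≤ wrap k N (wrap k 1 (λ _ _ → 0)) x i
  M≤W x i _ = ≤-trans (delay-matching≤below (k + (k + 1)) m x i)
    (≤-trans (below-mono (≤-trans (+-monoʳ-≤ (k + (k + 1)) (m≤m+n m m))
                                  (≤-reflexive (+-assoc k (k + 1) k))) x i) (m≤m+n _ _))

  deg′ : ∀ {v} → Layer k N v → onion k N d⁺ v + ⟦ k + N ≤ᵇ v ⟧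
         ≡ onion k N d v + ⟦ k + N ≤ᵇ v ⟧ + degree k M v
  deg′ {v} (low p)
    rewrite onion-low k N d p | onion-low k N d⁺ p
          | degree-delay-< k (k + (k + 1)) (matching m) v (≤-trans p (m≤m+n k (k + 1)))
          = sym (+-identityʳ _)
  deg′ (mid u p)
    rewrite onion-mid k N d p | onion-mid k N d⁺ p
          | ≤ᵇ-no {k + N} (+-monoʳ-< k p)
          | +-identityʳ (k + k + d⁺ u) | +-identityʳ (k + k + d u)
          | sym (+-assoc (k + k) (d u) ⟦ k + 1 ≤ᵇ u ⟧) with u <? k + 1
  ... | yes u< rewrite ≤ᵇ-no {k + 1} u<
          | degree-delay-< k (k + (k + 1)) (matching m) (k + u) (+-monoʳ-< k u<) = refl
  ... | no u≮
    rewrite ≤ᵇ-yes (≮⇒≥ u≮)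
          | degree-delay-≥ k (k + (k + 1)) (matching m) (+-monoʳ-≤ k (≮⇒≥ u≮))
          | [m+n]∸[m+o]≡n∸o k u (k + 1)
          | degree-matching-< {k} 1≤m (m≤m+n m m)
              (+-cancelˡ-< (k + 1) _ _ (subst (_< N) (sym (m+[n∸m]≡n (≮⇒≥ u≮))) p)) = refl
  deg′ (high u p)
    rewrite onion-high k N d u | onion-high k N d⁺ u
          | trans (cong (_+ u) (sym (+-assoc k (k + 1) k))) (+-assoc (k + (k + 1)) k u)
          | degree-delay-+ k (k + (k + 1)) (matching m) (k + u)
          | degree-matching-≥ {k} 1≤m (m≤m+n m m) (m≤m+n k u) = sym (+-identityʳ _)

-- Starting configurations from a star and an antiregular graph.

-- The star of all edges with upper endpoint `k`, which is the first middle vertex after a wrapping.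
hub : ℕ → EdgeFunction
hub k x i = ⟦ x + suc i ≡ᵇ k ⟧

-- Among the edges into `v` the test depends on `v` alone, so the sum is one of constants.
hub-in : ∀ k v → inSum k (hub k) v ≡ ⟦ v ≡ᵇ k ⟧ * (v ⊓ k)
hub-in k v = trans (inSum-cong k v (λ x i _ e → cong (λ y → ⟦ y ≡ᵇ k ⟧) e))
                   (inSum-const k ⟦ v ≡ᵇ k ⟧ v)

hub-out-< : ∀ {k v} → v < k → ∑ k (hub k v) ≡ 1
hub-out-< {k} {v} v<k = trans (∑-cong k eq) (∑-≡ᵇ k (k∸suc<k v<k))
  where
  eq : ∀ i → i < k → hub k v i ≡ ⟦ i ≡ᵇ k ∸ suc v ⟧
  eq i _ = begin
    ⟦ v + suc i ≡ᵇ k ⟧                     ≡⟨ cong (λ y → ⟦ v + suc i ≡ᵇ y ⟧)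
                                               (trans (+-suc v _) (m+[n∸m]≡n v<k)) ⟨
    ⟦ v + suc i ≡ᵇ v + suc (k ∸ suc v) ⟧   ≡⟨ ≡ᵇ-+ˡ v (suc i) (suc (k ∸ suc v)) ⟩
    ⟦ i ≡ᵇ k ∸ suc v ⟧                     ∎

hub-out-≥ : ∀ {k v} → k ≤ v → ∑ k (hub k v) ≡ 0
hub-out-≥ {k} {v} k≤v = trans (∑-cong k (λ i _ → ≡ᵇ-no (λ e → <⇒≢ (≤-trans (s≤s k≤v)
    (≤-trans (s≤s (m≤m+n v i)) (≤-reflexive (sym (+-suc v i))))) (sym e)))) (∑-zero k)

degree-hub-< : ∀ {k v} → v < k → degree k (hub k) v ≡ 1
degree-hub-< {k} {v} v<k = cong₂ _+_ (hub-out-< v<k)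
  (trans (hub-in k v) (cong (_* (v ⊓ k)) (≡ᵇ-no (<⇒≢ v<k))))

degree-hub-≡ : ∀ k → degree k (hub k) k ≡ k
degree-hub-≡ k = cong₂ _+_ (hub-out-≥ {k} ≤-refl)
  (trans (hub-in k k) (trans (cong₂ _*_ (≡ᵇ-refl k) (⊓-idem k)) (*-identityˡ k)))

degree-hub-> : ∀ {k v} → k < v → degree k (hub k) v ≡ 0
degree-hub-> {k} {v} k<v = cong₂ _+_ (hub-out-≥ (<⇒≤ k<v))
  (trans (hub-in k v) (cong (_* (v ⊓ k)) (≡ᵇ-no (≢-sym (<⇒≢ k<v)))))

data Threshold (X Y : ℕ) : ℕ → Set where
  first  : Threshold X Y 0
  clique : ∀ u → suc u < X → Threshold X Y (suc u)
  coclique : ∀ t → t < Y → Threshold X Y (X + t)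

threshold-view : ∀ X Y u → u < X + Y → Threshold X Y u
threshold-view X Y zero    _ = first
threshold-view X Y (suc u) u< with suc u <? X
... | yes u<X = clique u u<X
... | no  u≮X = subst (Threshold X Y) (m+[n∸m]≡n X≤u) (coclique (suc u ∸ X)
        (+-cancelˡ-< X _ _ (subst (_< X + Y) (sym (m+[n∸m]≡n X≤u)) u<)))
  where X≤u = ≮⇒≥ u≮X

-- On X + Y vertices with X - 1 ≤ Y ≤ X this threshold graph is antiregular:
-- the vertices 0 and X are the only two of equal degree.
threshold : ℕ → ℕ → EdgeFunction
threshold X Y x i = below X x i * ⟦ i <ᵇ Y ⟧

module _ {k X Y : ℕ} (1≤k : 1 ≤ k) (1≤X : 1 ≤ X) (X≤k : X ≤ k) (X≤1+Y : X ≤ suc Y) (Y≤X : Y ≤ X) where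

  private
    p = X + Y
    Y≤k = ≤-trans Y≤X X≤k

  threshold-out : ∀ u → ∑ k (threshold X Y u) ≡ ⟦ u <ᵇ X ⟧ * Y
  threshold-out u = trans (∑-*ˡ k ⟦ u <ᵇ X ⟧ _) (cong (⟦ u <ᵇ X ⟧ *_) (∑-<ᵇ k Y≤k))

  -- `X ≤ suc Y` puts every earlier vertex of the clique within distance `Y`.
  degree-clique : ∀ {u} → u < X → degree k (threshold X Y) u ≡ Y + u
  degree-clique {u} u<X = cong₂ _+_
    (trans (threshold-out u) (trans (cong (_* Y) (<ᵇ-yes u<X)) (*-identityˡ Y)))
    (trans (inSum-<ᵇʳ k (below X) u Y≤k)
    (trans (inSum-below-≤ Y u (<⇒≤ u<X)) (m≤n⇒m⊓n≡m (≤-pred (≤-trans u<X X≤1+Y)))))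

  degree-coclique : ∀ t → degree k (threshold X Y) (X + t) ≡ Y ∸ t
  degree-coclique t = cong₂ _+_
    (trans (threshold-out (X + t)) (cong (_* Y) (<ᵇ-no (m≤m+n X t))))
    (trans (inSum-<ᵇʳ k (below X) (X + t) Y≤k)
    (trans (inSum-below-≥ Y X t) (m≥n⇒m⊓n≡n (≤-trans (m∸n≤m Y t) Y≤X))))

  -- One less than the threshold degree with the star added: the star lifts vertex 0 from `Y` to
  -- `Y + k`, above all others, and leaves the other middle vertices alone.
  topDegree : ℕ → ℕ
  topDegree zero    = Y + pred k
  topDegree (suc u) = if suc u <ᵇ X then Y + u else Y ∸ suc (suc u ∸ X)

  topDegree-clique : ∀ {u} → suc u < X → topDegree (suc u) ≡ Y + u
  topDegree-clique u<X rewrite <ᵇ-true u<X = refl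

  topDegree-coclique : ∀ t → topDegree (X + t) ≡ Y ∸ suc t
  topDegree-coclique t with X + t in eq
  ... | zero  = contradiction (≤-trans 1≤X (≤-trans (m≤m+n X t) (≤-reflexive eq))) λ ()
  ... | suc u rewrite sym eq | <ᵇ-false (m≤m+n X t) | m+n∸m≡n X t = refl

  topDegree-injective : InjectiveBelow p topDegree
  topDegree-injective u v u< v< = go (threshold-view X Y u u<) (threshold-view X Y v v<)
    where
    go : ∀ {u v} → Threshold X Y u → Threshold X Y v → topDegree u ≡ topDegree v → u ≡ v
    go first first e = refl
    go (clique a p) (clique b q) e rewrite topDegree-clique p | topDegree-clique q =
      cong suc (+-cancelˡ-≡ Y _ _ e)
    go (coclique a p) (coclique b q) e rewrite topDegree-coclique a | topDegree-coclique b =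
      cong (X +_) (suc-injective (∸-cancelˡ-≡ p q e))
    -- `suc a < X ≤ k` keeps `Y + a` below `Y + pred k`.
    go (clique a p) first e rewrite topDegree-clique p =
      contradiction e (<⇒≢ (+-monoʳ-< Y (<⇒≤pred (≤-trans p X≤k))))
    go first (clique b q) e = sym (go (clique b q) first (sym e))
    go (coclique a p) first e rewrite topDegree-coclique a =
      contradiction e (<⇒≢ (≤-trans (k∸suc<k p) (m≤m+n Y (pred k))))
    go first (coclique b q) e = sym (go (coclique b q) first (sym e))
    go (coclique a p) (clique b q) e rewrite topDegree-coclique a | topDegree-clique q =
      contradiction e (<⇒≢ (≤-trans (k∸suc<k p) (m≤m+n Y b)))
    go (clique b q) (coclique a p) e = sym (go (coclique a p) (clique b q) (sym e))

  threshold-real : IsRealisation k 1 p (degree k (threshold X Y)) (threshold X Y)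
  threshold-real = bound , supp , λ _ _ → refl
    where
    bound : Bounded k 1 (threshold X Y)
    bound x i _ = *-mono-≤ (⟦⟧≤1 (x <ᵇ X)) (⟦⟧≤1 (i <ᵇ Y))
    supp : Supported k p (threshold X Y)
    supp x i _ p≤ with x <? X | i <? Y
    ... | yes x<X | yes i<Y = contradiction p≤ (<⇒≱ (+-mono-<-≤ x<X i<Y))
    ... | no  x≮X | _       = cong (_* ⟦ i <ᵇ Y ⟧) (<ᵇ-no (≮⇒≥ x≮X))
    ... | yes _   | no  i≮Y = trans (cong (⟦ x <ᵇ X ⟧ *_) (<ᵇ-no (≮⇒≥ i≮Y))) (*-zeroʳ ⟦ x <ᵇ X ⟧)

  capped : EdgeFunction
  capped = wrap k p (threshold X Y) ⊕ hub k

  -- The star adds 1 throughout the first block, the last block has its surplus 1, and `topDegree`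
  -- is 1 below the true middle degrees; hence the shift of `onion` is uniform.
  capped-degree : ∀ v → v < k + p + k → degree k capped v ≡ suc (onion k p topDegree v)
  capped-degree v v< = begin
    degree k capped v
      ≡⟨ degree-⊕ k (wrap k p (threshold X Y)) (hub k) v ⟩
    degree k (wrap k p (threshold X Y)) v + degree k (hub k) v
      ≡⟨ cong (_+ degree k (hub k) v) (proj₂ (proj₂ (wrap-realises threshold-real)) v v<) ⟩
    onion k p r v + ⟦ k + p ≤ᵇ v ⟧ + degree k (hub k) v
      ≡⟨ go (layer k p v v<) ⟩
    suc (onion k p topDegree v)   ∎
    where
    r : ℕ → ℕ
    r = degree k (threshold X Y)

    top : ∀ {u} → Threshold X Y u → r u + degree k (hub k) (k + u) ≡ suc (topDegree u)
    top first rewrite +-identityʳ k | degree-hub-≡ k | degree-clique 1≤X | +-identityʳ Y =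
      trans (cong (Y +_) (sym (suc-pred k ⦃ >-nonZero 1≤k ⦄))) (+-suc Y (pred k))
    top (clique u q) rewrite degree-clique q | topDegree-clique q | degree-hub-> (m<m+n k {suc u} z<s) =
      trans (+-identityʳ _) (+-suc Y u)
    top (coclique t q)
      rewrite degree-coclique t | topDegree-coclique t
            | degree-hub-> (m<m+n k (≤-trans 1≤X (m≤m+n X t))) =
      trans (+-identityʳ _) (∸≡suc∸suc q)

    go : ∀ {v} → Layer k p v →
         onion k p r v + ⟦ k + p ≤ᵇ v ⟧ + degree k (hub k) v ≡ suc (onion k p topDegree v)
    go {v} (low q)
      rewrite onion-low k p r q | onion-low k p topDegree q
            | ≤ᵇ-no {k + p} (≤-trans q (m≤m+n k p)) | degree-hub-< q
            | +-identityʳ (k + v) = +-comm (k + v) 1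
    go (mid u q)
      rewrite onion-mid k p r q | onion-mid k p topDegree q
            | ≤ᵇ-no {k + p} (+-monoʳ-< k q) | +-identityʳ (k + k + r u) =
      trans (+-assoc (k + k) (r u) _)
      (trans (cong (k + k +_) (top (threshold-view X Y u q))) (+-suc (k + k) (topDegree u)))
    go (high u q)
      rewrite onion-high k p r u | onion-high k p topDegree u
            | ≤ᵇ-yes (m≤m+n (k + p) u)
            | degree-hub-> (≤-trans (m<m+n k (≤-trans 1≤X (m≤m+n X Y))) (m≤m+n (k + p) u)) =
      trans (+-identityʳ _) (+-comm (k ∸ suc u) 1)

  -- Star edges start in the first block, where the delayed threshold labels vanish, so at most two
  -- ones meet on an edge.
  capped-bound : Bounded k 2 capped
  capped-bound x i i<k with x <? k
  ... | yes x<k = ≤-trans (+-mono-≤ (+-mono-≤ (⟦⟧≤1 (x <ᵇ k + p)) (≤-reflexive (delay-< k _ x i x<k)))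
                                    (⟦⟧≤1 (x + suc i ≡ᵇ k))) (≤-refl {2})
  ... | no  x≮k = ≤-trans (+-mono-≤ (proj₁ (wrap-realises threshold-real) x i i<k)
                    (≤-reflexive (≡ᵇ-no (λ e → x≮k (≤-trans (m<m+n x z<s) (≤-reflexive e))))))
                    (≤-reflexive (+-identityʳ 2))

  capped-supported : Supported k (k + p + k) capped
  capped-supported x i i<k le = cong₂ _+_
    (proj₁ (proj₂ (wrap-realises threshold-real)) x i i<k le)
    (≡ᵇ-no (≢-sym (<⇒≢ (≤-trans (m<m+n k 1≤k) (≤-trans (+-monoˡ-≤ k (m≤m+n k p)) le)))))

  capped-irregular : IrregularPath k 2 (k + p + k)
  capped-irregular = suc ∘ onion k p topDegree
    , (capped , capped-bound , capped-supported , capped-degree)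
    , λ u v u< v< e → onion-injective k p topDegree topDegree-injective u v u< v< (suc-injective e)

  -- The same labelling with the shift of the last block charged to the correction term. The last
  -- block then keeps its `onion` values, all below `k`, while the others, all at least `k`, stay
  -- raised by 1; so `d` is a strictly increasing function of `onion`.
  capped-almostIrregularPath : AlmostIrregularPath k 2 (k + p)
  capped-almostIrregularPath = d
    , (capped , capped-bound , capped-supported
      , λ v v< → trans (capped-degree v v<) (split v))
    , λ u v u< v< e → onion-injective k p topDegree topDegree-injective u v u< v<
        (raise-injective (trans (sym (d≡raise (layer k p u u<))) (trans e (d≡raise (layer k p v v<)))))
    where
    d : ℕ → ℕ
    d v = onion k p topDegree v + ⟦ v <ᵇ k + p ⟧

    split : ∀ v → suc (onion k p topDegree v) ≡ d v + ⟦ k + p ≤ᵇ v ⟧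
    split v with v <? k + p
    ... | yes v< rewrite <ᵇ-yes v< | ≤ᵇ-no {k + p} v< =
      sym (trans (+-identityʳ _) (+-comm _ 1))
    ... | no  v≮ rewrite <ᵇ-no (≮⇒≥ v≮) | ≤ᵇ-yes (≮⇒≥ v≮) =
      sym (trans (cong (_+ 1) (+-identityʳ _)) (+-comm _ 1))

    raise : ℕ → ℕ
    raise t = t + ⟦ k ≤ᵇ t ⟧

    raise-mono : ∀ {s t} → s < t → raise s < raise t
    raise-mono {s} {t} s<t with s <? k
    ... | yes s<k rewrite ≤ᵇ-no {k} s<k | +-identityʳ s = ≤-trans s<t (m≤m+n t _)
    ... | no  s≮k rewrite ≤ᵇ-yes (≮⇒≥ s≮k) | ≤ᵇ-yes (≤-trans (≮⇒≥ s≮k) (<⇒≤ s<t)) = +-monoˡ-< 1 s<t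

    raise-injective : ∀ {s t} → raise s ≡ raise t → s ≡ t
    raise-injective {s} {t} e with <-cmp s t
    ... | tri< s<t _ _ = contradiction e (<⇒≢ (raise-mono s<t))
    ... | tri≈ _ s≡t _ = s≡t
    ... | tri> _ _ t<s = contradiction (sym e) (<⇒≢ (raise-mono t<s))

    d≡raise : ∀ {v} → Layer k p v → d v ≡ raise (onion k p topDegree v)
    d≡raise {v} (low q)
      rewrite onion-low k p topDegree q | ≤ᵇ-yes (m≤m+n k v)
            | <ᵇ-yes (≤-trans q (m≤m+n k p)) = refl
    d≡raise (mid u q)
      rewrite onion-mid k p topDegree q | <ᵇ-yes (+-monoʳ-< k q)
            | ≤ᵇ-yes (≤-trans (m≤m+n k k) (m≤m+n (k + k) (topDegree u))) = refl
    d≡raise (high u q)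
      rewrite onion-high k p topDegree u | <ᵇ-no (m≤m+n (k + p) u) | ≤ᵇ-no {k} (k∸suc<k q) = refl

-- Finite sums over `Fin`.

sumFin≡sum : ∀ {n} (f : Fin n → ℕ) → sumFin f ≡ sum f
sumFin≡sum {zero}  f = refl
sumFin≡sum {suc n} f = cong (f Fin.zero +_) (sumFin≡sum (f ∘ Fin.suc))

sumFin-cong : ∀ {n} {f g : Fin n → ℕ} → (∀ i → f i ≡ g i) → sumFin f ≡ sumFin g
sumFin-cong {zero}  eq = refl
sumFin-cong {suc n} eq = cong₂ _+_ (eq Fin.zero) (sumFin-cong (eq ∘ Fin.suc))

sumFin-swap : ∀ {m n} (f : Fin m → Fin n → ℕ) →
  sumFin (λ i → sumFin (f i)) ≡ sumFin (λ j → sumFin (λ i → f i j))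
sumFin-swap f = begin
  sumFin (λ i → sumFin (f i))            ≡⟨ sumFin-cong (λ i → sumFin≡sum (f i)) ⟩
  sumFin (λ i → sum (f i))               ≡⟨ sumFin≡sum (λ i → sum (f i)) ⟩
  sum (λ i → sum (f i))                  ≡⟨ ∑-comm f ⟩
  sum (λ j → sum (λ i → f i j))          ≡⟨ sumFin≡sum (λ j → sum (λ i → f i j)) ⟨
  sumFin (λ j → sum (λ i → f i j))       ≡⟨ sumFin-cong (λ j → sumFin≡sum (λ i → f i j)) ⟨
  sumFin (λ j → sumFin (λ i → f i j))    ∎

sumFin-+ : ∀ {n} (f g : Fin n → ℕ) → sumFin (λ i → f i + g i) ≡ sumFin f + sumFin g
sumFin-+ f g = begin
  sumFin (λ i → f i + g i)   ≡⟨ sumFin≡sum (λ i → f i + g i) ⟩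
  sum (λ i → f i + g i)      ≡⟨ ∑-distrib-+ f g ⟩
  sum f + sum g              ≡⟨ cong₂ _+_ (sumFin≡sum f) (sumFin≡sum g) ⟨
  sumFin f + sumFin g        ∎

sumFin-permute : ∀ {n} (f : Fin n → ℕ) (to from : Fin n → Fin n) →
  (∀ x → to (from x) ≡ x) → (∀ x → from (to x) ≡ x) → sumFin (f ∘ to) ≡ sumFin f
sumFin-permute f to from tf ft = begin
  sumFin (f ∘ to)   ≡⟨ sumFin≡sum (f ∘ to) ⟩
  sum (f ∘ to)      ≡⟨ sum-permute f (permutation to from tf ft) ⟨
  sum f             ≡⟨ sumFin≡sum f ⟨
  sumFin f          ∎

sumFin-const : ∀ n c → sumFin {n} (λ _ → c) ≡ n * c
sumFin-const zero    c = refl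
sumFin-const (suc n) c = cong (c +_) (sumFin-const n c)

sumFin-toℕ : ∀ n (f : ℕ → ℕ) → sumFin {n} (f ∘ toℕ) ≡ ∑ n f
sumFin-toℕ zero    f = refl
sumFin-toℕ (suc n) f = cong (f 0 +_) (sumFin-toℕ n (f ∘ suc))

sumFin-mono : ∀ {n} {f g : Fin n → ℕ} → (∀ i → f i ≤ g i) → sumFin f ≤ sumFin g
sumFin-mono {zero}  le = z≤n
sumFin-mono {suc n} le = +-mono-≤ (le Fin.zero) (sumFin-mono (le ∘ Fin.suc))

-- Totals without slack leave none to any summand; this turns an extremal weighted degree into
-- information on every single edge.
sumFin-squeeze : ∀ {n} {f g : Fin n → ℕ} → (∀ i → f i ≤ g i) → sumFin g ≤ sumFin f →
                 ∀ i → g i ≤ f i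
sumFin-squeeze {suc n} {f} {g} le total Fin.zero =
  +-cancelʳ-≤ (sumFin (f ∘ Fin.suc)) _ _
    (≤-trans (+-monoʳ-≤ (g Fin.zero) (sumFin-mono (le ∘ Fin.suc))) total)
sumFin-squeeze {suc n} {f} {g} le total (Fin.suc i) = sumFin-squeeze (le ∘ Fin.suc)
  (+-cancelˡ-≤ (f Fin.zero) _ _ (≤-trans (+-monoˡ-≤ (sumFin (g ∘ Fin.suc)) (le Fin.zero)) total)) i

sumFin-single : ∀ {n} (f : Fin n → ℕ) x → (∀ y → y ≢ x → f y ≡ 0) → sumFin f ≡ f x
sumFin-single {suc n} f Fin.zero others = trans (cong (f Fin.zero +_)
  (trans (sumFin-cong {f = f ∘ Fin.suc} (λ y → others (Fin.suc y) (λ ()))) (trans (sumFin-const n 0) (*-zeroʳ n))))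
  (+-identityʳ _)
sumFin-single {suc n} f (Fin.suc x) others = cong₂ _+_ (others Fin.zero (λ ()))
  (sumFin-single (f ∘ Fin.suc) x (λ y y≢x → others (Fin.suc y) (y≢x ∘ Fin.suc-injective)))

-- Cyclic shifts and weighted degrees.

toℕ-shift : ∀ {n} .⦃ _ : NonZero n ⦄ (x : Fin n) d → toℕ (shift x d) ≡ (toℕ x + d) % n
toℕ-shift {suc m} x d = Fin.toℕ-fromℕ< (m%n<n (toℕ x + d) (suc m))

%-+ˡ : ∀ a b n .⦃ _ : NonZero n ⦄ → (a % n + b) % n ≡ (a + b) % n
%-+ˡ a b n = begin
  (a % n + b) % n           ≡⟨ %-distribˡ-+ (a % n) b n ⟩
  (a % n % n + b % n) % n   ≡⟨ cong (λ c → (c + b % n) % n) (m%n%n≡m%n a n) ⟩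
  (a % n + b % n) % n       ≡⟨ %-distribˡ-+ a b n ⟨
  (a + b) % n               ∎

shift-shift : ∀ {n} .⦃ _ : NonZero n ⦄ (x : Fin n) {a b} → a + b ≡ n → shift (shift x a) b ≡ x
shift-shift {n} x {a} {b} a+b≡n = Fin.toℕ-injective (begin
  toℕ (shift (shift x a) b)   ≡⟨ toℕ-shift (shift x a) b ⟩
  (toℕ (shift x a) + b) % n   ≡⟨ cong (λ y → (y + b) % n) (toℕ-shift x a) ⟩
  ((toℕ x + a) % n + b) % n   ≡⟨ %-+ˡ (toℕ x + a) b n ⟩
  (toℕ x + a + b) % n         ≡⟨ cong (_% n) (+-assoc (toℕ x) a b) ⟩
  (toℕ x + (a + b)) % n       ≡⟨ cong (λ y → (toℕ x + y) % n) a+b≡n ⟩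
  (toℕ x + n) % n             ≡⟨ [m+n]%n≡m%n (toℕ x) n ⟩
  toℕ x % n                   ≡⟨ m<n⇒m%n≡m (Fin.toℕ<n x) ⟩
  toℕ x                       ∎)

-- The sum `toℕ x + d` either stays below `n` and exceeds `toℕ x`, or wraps once and lands below it.
shift-≢ : ∀ {n} .⦃ _ : NonZero n ⦄ (x : Fin n) {d} → 0 < d → d < n → shift x d ≢ x
shift-≢ {n} x {d} 0<d d<n e with toℕ x + d <? n
... | yes x+d<n = <⇒≢ (m<m+n (toℕ x) 0<d)
      (trans (cong toℕ (sym e)) (trans (toℕ-shift x d) (m<n⇒m%n≡m x+d<n)))
... | no  x+d≮n = <⇒≢ lt (trans (sym x′≡) (trans (sym (toℕ-shift x d)) (cong toℕ e)))
  where
  n≤x+d = ≮⇒≥ x+d≮n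
  lt : toℕ x + d ∸ n < toℕ x
  lt = +-cancelʳ-< n _ _ (subst (_< toℕ x + n) (sym (m∸n+n≡m n≤x+d)) (+-monoʳ-< (toℕ x) d<n))
  x′≡ : (toℕ x + d) % n ≡ toℕ x + d ∸ n
  x′≡ = trans (cong (_% n) (sym (m∸n+n≡m n≤x+d)))
        (trans ([m+n]%n≡m%n (toℕ x + d ∸ n) n) (m<n⇒m%n≡m (<-trans lt (Fin.toℕ<n x))))

back : ∀ {n} → Fin n → ℕ → Fin n
back {n} v d = shift v (n ∸ d)

back-shift : ∀ {n} .⦃ _ : NonZero n ⦄ (x : Fin n) {d} → d ≤ n → back (shift x d) d ≡ x
back-shift x d≤n = shift-shift x (m+[n∸m]≡n d≤n)

shift-back : ∀ {n} .⦃ _ : NonZero n ⦄ (x : Fin n) {d} → d ≤ n → shift (back x d) d ≡ x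
shift-back x d≤n = shift-shift x (m∸n+n≡m d≤n)

edges : ∀ {n k} → Labelling n k → Fin n → Fin k → ℕ
edges w v i = w v i + w (back v (suc (toℕ i))) i

-- For each `i` the incidence test selects the edges starting at `v` and at `back v (suc (toℕ i))`.
-- A shift by at most `k < n` has no fixed point, so the disjunction is exclusive and splits into a
-- sum.
wd≡ : ∀ {n k} .⦃ _ : NonZero n ⦄ → k < n → (w : Labelling n k) → ∀ v → wd w v ≡ sumFin (edges w v)
wd≡ {n} {k} k<n w v = trans
  (sumFin-swap (λ x i → if incident v x i then w x i else 0)) (sumFin-cong column)
  where
  step : Fin k → ℕ
  step i = suc (toℕ i)
  step<n : ∀ i → step i < n
  step<n i = ≤-trans (s≤s (Fin.toℕ<n i)) k<n

  at : Fin k → Fin n → ℕ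
  at i x = if does (v Fin.≟ x) then w x i else 0
  shifted : Fin k → Fin n → ℕ
  shifted i x = if does (v Fin.≟ shift x (step i)) then w x i else 0

  split : ∀ i x → (if incident v x i then w x i else 0) ≡ at i x + shifted i x
  split i x with v Fin.≟ x | v Fin.≟ shift x (step i)
  ... | yes refl | yes e = contradiction (sym e) (shift-≢ x z<s (step<n i))
  ... | yes _    | no  _ = sym (+-identityʳ (w x i))
  ... | no  _    | yes _ = refl
  ... | no  _    | no  _ = refl

  at-v : ∀ i → at i v ≡ w v i
  at-v i with v Fin.≟ v
  ... | yes _   = refl
  ... | no  v≢v = contradiction refl v≢v

  at-others : ∀ i x → x ≢ v → at i x ≡ 0
  at-others i x x≢v with v Fin.≟ x
  ... | yes v≡x = contradiction (sym v≡x) x≢v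
  ... | no  _   = refl

  shifted-back : ∀ i → shifted i (back v (step i)) ≡ w (back v (step i)) i
  shifted-back i with v Fin.≟ shift (back v (step i)) (step i)
  ... | yes _ = refl
  ... | no  ≢ = contradiction (sym (shift-back v (<⇒≤ (step<n i)))) ≢

  shifted-others : ∀ i x → x ≢ back v (step i) → shifted i x ≡ 0
  shifted-others i x x≢ with v Fin.≟ shift x (step i)
  ... | yes refl = contradiction (sym (back-shift x (<⇒≤ (step<n i)))) x≢
  ... | no  _    = refl

  column : ∀ i → sumFin (λ x → if incident v x i then w x i else 0) ≡ edges w v i
  column i = begin
    sumFin (λ x → if incident v x i then w x i else 0)   ≡⟨ sumFin-cong (split i) ⟩
    sumFin (λ x → at i x + shifted i x)                  ≡⟨ sumFin-+ (at i) (shifted i) ⟩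
    sumFin (at i) + sumFin (shifted i)
      ≡⟨ cong₂ _+_ (trans (sumFin-single (at i) v (at-others i)) (at-v i))
                   (trans (sumFin-single (shifted i) (back v (step i)) (shifted-others i))
                          (shifted-back i)) ⟩
    edges w v i                                          ∎

-- Handshake lemma: stepping back by a fixed length permutes the vertices, so entering and leaving
-- edges of that length have equal totals.
sum-wd : ∀ {n k} .⦃ _ : NonZero n ⦄ → k < n → (w : Labelling n k) →
         sumFin (wd w) ≡ 2 * sumFin (λ i → sumFin (λ x → w x i))
sum-wd {n} {k} k<n w = begin
  sumFin (wd w)                                       ≡⟨ sumFin-cong (wd≡ k<n w) ⟩
  sumFin (λ v → sumFin (edges w v))                   ≡⟨ sumFin-swap (edges w) ⟩
  sumFin (λ i → sumFin (λ v → edges w v i))           ≡⟨ sumFin-cong column ⟩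
  sumFin (λ i → total i + total i)                    ≡⟨ sumFin-+ total total ⟩
  sumFin total + sumFin total                         ≡⟨ cong (sumFin total +_) (+-identityʳ _) ⟨
  2 * sumFin total                                    ∎
  where
  total : Fin k → ℕ
  total i = sumFin (λ x → w x i)
  column : ∀ i → sumFin (λ v → edges w v i) ≡ total i + total i
  column i = trans (sumFin-+ (λ v → w v i) (λ v → w (back v d) i))
    (cong (total i +_) (sumFin-permute (λ x → w x i) (λ v → back v d) (λ v → shift v d)
      (λ x → back-shift x d≤n) (λ x → shift-back x d≤n)))
    where
    d = suc (toℕ i)
    d≤n : d ≤ n
    d≤n = ≤-trans (Fin.toℕ<n i) (<⇒≤ k<n)

-- From path powers to cycle powers.

inSum≡∑ : ∀ k F v → inSum k F v ≡ ∑ k (λ i → if i <ᵇ v then F (v ∸ suc i) i else 0)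
inSum≡∑ zero    F v       = refl
inSum≡∑ (suc k) F zero    = sym (∑-zero k)
inSum≡∑ (suc k) F (suc v) = cong (F v 0 +_) (inSum≡∑ k (λ x i → F x (suc i)) v)

cyclic : ∀ {n k} → EdgeFunction → Labelling n k
cyclic F x i = suc (F (toℕ x) (toℕ i))

-- The summand `2 * k` comes from the 1 added to every label. An edge entering `v` either comes from
-- a smaller vertex, as in the path, or closes the cycle and has label 0 in `F`.
wd-cyclic : ∀ {n k F} .⦃ _ : NonZero n ⦄ → k < n → Supported k n F → ∀ (v : Fin n) →
            wd (cyclic {n} {k} F) v ≡ 2 * k + degree k F (toℕ v)
wd-cyclic {n} {k} {F} k<n supp v = begin
  wd (cyclic {n} {k} F) v                               ≡⟨ wd≡ k<n (cyclic F) v ⟩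
  sumFin {k} (λ i → edges (cyclic F) v i)               ≡⟨ sumFin-cong {k} pointwise ⟩
  sumFin {k} (λ i → 2 + (F (toℕ v) (toℕ i) + prev (toℕ i)))
    ≡⟨ sumFin-toℕ k (λ i → 2 + (F (toℕ v) i + prev i)) ⟩
  ∑ k (λ i → 2 + (F (toℕ v) i + prev i))                ≡⟨ ∑-+ k (λ _ → 2) _ ⟩
  ∑ k (λ _ → 2) + ∑ k (λ i → F (toℕ v) i + prev i)
    ≡⟨ cong₂ _+_ (trans (∑-const k 2) (*-comm k 2)) (∑-+ k (F (toℕ v)) prev) ⟩
  2 * k + (∑ k (F (toℕ v)) + ∑ k prev)
    ≡⟨ cong (λ z → 2 * k + (∑ k (F (toℕ v)) + z)) (inSum≡∑ k F (toℕ v)) ⟨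
  2 * k + degree k F (toℕ v)                            ∎
  where
  prev : ℕ → ℕ
  prev i = if i <ᵇ toℕ v then F (toℕ v ∸ suc i) i else 0

  value : ∀ i → i < k → F (toℕ (back v (suc i))) i ≡ prev i
  value i i<k with i <? toℕ v
  ... | yes i<v rewrite <ᵇ-true i<v = cong (λ x → F x i) (begin
    toℕ (shift v (n ∸ suc i))         ≡⟨ toℕ-shift v (n ∸ suc i) ⟩
    (toℕ v + (n ∸ suc i)) % n         ≡⟨ cong (_% n) (+-∸-assoc (toℕ v) (<-trans i<v (Fin.toℕ<n v))) ⟨
    (toℕ v + n ∸ suc i) % n           ≡⟨ cong (_% n) (+-∸-comm n i<v) ⟩
    (toℕ v ∸ suc i + n) % n           ≡⟨ [m+n]%n≡m%n (toℕ v ∸ suc i) n ⟩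
    (toℕ v ∸ suc i) % n               ≡⟨ m<n⇒m%n≡m (≤-trans (s≤s (m∸n≤m (toℕ v) (suc i))) (Fin.toℕ<n v)) ⟩
    toℕ v ∸ suc i                     ∎)
  -- This edge wraps around: its start plus `suc i` is `n + toℕ v`.
  ... | no  i≮v rewrite <ᵇ-false (≮⇒≥ i≮v) = supp _ i i<k (≤-trans (m≤m+n n (toℕ v)) (≤-reflexive (sym (begin
    toℕ (shift v (n ∸ suc i)) + suc i   ≡⟨ cong (_+ suc i) (trans (toℕ-shift v (n ∸ suc i)) (m<n⇒m%n≡m small)) ⟩
    toℕ v + (n ∸ suc i) + suc i         ≡⟨ +-assoc (toℕ v) (n ∸ suc i) (suc i) ⟩
    toℕ v + (n ∸ suc i + suc i)         ≡⟨ cong (toℕ v +_) (m∸n+n≡m i<n) ⟩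
    toℕ v + n                           ≡⟨ +-comm (toℕ v) n ⟩
    n + toℕ v                           ∎))))
    where
    i<n : i < n
    i<n = <-trans i<k k<n
    small : toℕ v + (n ∸ suc i) < n
    small = ≤-trans (+-monoˡ-≤ (n ∸ suc i) (s≤s (≮⇒≥ i≮v))) (≤-reflexive (m+[n∸m]≡n i<n))

  pointwise : ∀ i → edges (cyclic {n} {k} F) v i ≡ 2 + (F (toℕ v) (toℕ i) + prev (toℕ i))
  pointwise i = trans (+-suc (suc (F (toℕ v) (toℕ i))) _)
    (cong (λ z → 2 + (F (toℕ v) (toℕ i) + z)) (value (toℕ i) (Fin.toℕ<n i)))

irregular⇒labelling : ∀ {n k s} .⦃ _ : NonZero n ⦄ → k < n → IrregularPath k s n → HasIrregularLabelling n k (suc s)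
irregular⇒labelling {n} {k} k<n (d , (F , bound , supp , deg) , inj) =
  cyclic F
  , (λ x i → z<s , s≤s (bound (toℕ x) (toℕ i) (Fin.toℕ<n i)))
  , λ {u} {v} e → Fin.toℕ-injective (inj _ _ (Fin.toℕ<n u) (Fin.toℕ<n v)
      (trans (sym (deg _ (Fin.toℕ<n u)))
      (trans (+-cancelˡ-≡ (2 * k) _ _ (trans (sym (wd-cyclic {n} {k} {F} k<n supp u)) (trans e (wd-cyclic {n} {k} {F} k<n supp v))))
             (deg _ (Fin.toℕ<n v)))))

-- Lower bounds by counting, by parity and in the complete graph.

-- Punching out a missed value would inject `Fin (suc n)` into `Fin n`.
injective⇒surjective : ∀ {n} {f : Fin n → Fin n} → Injective _≡_ _≡_ f → ∀ y → ∃[ x ] f x ≡ y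
injective⇒surjective {suc n} {f} inj y with Fin.any? (λ x → f x Fin.≟ y)
... | yes hit  = hit
... | no  miss = contradiction (Fin.injective⇒≤ {f = λ x → Fin.punchOut (y≢ x)}
        (λ {u} {v} e → inj (Fin.punchOut-injective (y≢ u) (y≢ v) e))) 1+n≰n
  where
  y≢ : ∀ x → y ≢ f x
  y≢ x y≡fx = miss (x , sym y≡fx)

sum-below : ∀ n → 2 * ∑ n (λ i → i) + n ≡ n * n
sum-below zero    = refl
sum-below (suc n) = begin
  2 * ∑ n suc + suc n                      ≡⟨ cong (λ z → 2 * z + suc n) (∑-+ n (λ _ → 1) (λ i → i)) ⟩
  2 * (∑ n (λ _ → 1) + T) + suc n          ≡⟨ cong (λ z → 2 * (z + T) + suc n) (trans (∑-const n 1) (*-identityʳ n)) ⟩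
  2 * (n + T) + suc n                      ≡⟨ rearrange n T ⟩
  2 * T + n + suc (2 * n)                  ≡⟨ cong (_+ suc (2 * n)) (sum-below n) ⟩
  n * n + suc (2 * n)                      ≡⟨ square n ⟩
  suc n * suc n                            ∎
  where
  T : ℕ
  T = ∑ n (λ i → i)
  rearrange : ∀ n T → 2 * (n + T) + suc n ≡ 2 * T + n + suc (2 * n)
  rearrange = solve-∀
  square : ∀ n → n * n + suc (2 * n) ≡ suc n * suc n
  square = solve-∀

module _ {n k t : ℕ} .⦃ _ : NonZero n ⦄ (k<n : k < n) (w : Labelling n k)
         (range : InRange (suc t) w) (irr : Irregular w) where

  wd-≥ : ∀ v → k * 2 ≤ wd w v
  wd-≥ v = subst₂ _≤_ (sumFin-const k 2) (sym (wd≡ k<n w v))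
    (sumFin-mono (λ i → +-mono-≤ (proj₁ (range v i)) (proj₁ (range _ i))))

  edges≤ : ∀ v i → edges w v i ≤ 2 + (t + t)
  edges≤ v i = ≤-trans (+-mono-≤ (proj₂ (range v i)) (proj₂ (range _ i)))
                       (≤-reflexive (cong suc (+-suc t t)))

  wd-≤ : ∀ v → wd w v ≤ k * 2 + k * (t + t)
  wd-≤ v = ≤-trans (≤-reflexive (wd≡ k<n w v)) (≤-trans (sumFin-mono (edges≤ v))
    (≤-reflexive (trans (sumFin-const k _) (*-distribˡ-+ k 2 (t + t)))))

  -- The position of the weighted degree in `[2k , 2k(t + 1)]`, where `suc t` bounds the labels.
  rank : Fin n → Fin (suc (k * (t + t)))
  rank v = fromℕ< (s≤s (m≤n+o⇒m∸n≤o (wd w v) (k * 2) (wd-≤ v)))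

  wd≡rank : ∀ v → wd w v ≡ k * 2 + toℕ (rank v)
  wd≡rank v = sym (trans (cong (k * 2 +_) (Fin.toℕ-fromℕ< _)) (m+[n∸m]≡n (wd-≥ v)))

  rank-injective : Injective _≡_ _≡_ rank
  rank-injective {u} {v} e =
    irr (trans (wd≡rank u) (trans (cong (λ x → k * 2 + toℕ x) e) (sym (wd≡rank v))))

  n≤range : n ≤ suc (k * (t + t))
  n≤range = Fin.injective⇒≤ rank-injective

-- Tightness makes `rank` a bijection, so the weighted degrees sum to
-- `2nk + n(n - 1)/2 = 2nk + nkt`. This is odd because `n`, `k` and `t` are, against the handshake
-- lemma.
odd-tight-impossible : ∀ {n} K a → let k = suc (2 * K); t = suc (2 * a) in
  .⦃ _ : NonZero n ⦄ → n ≡ suc (k * (t + t)) → k < n → (w : Labelling n k) →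
  InRange (suc t) w → ¬ Irregular w
odd-tight-impossible K a refl k<n w range irr =
  -- The long term is half of the sum minus 1: multiply out `n * k * t` with `n = 2kt + 1`,
  -- `k = 2K + 1`, `t = 2a + 1`, and add `n * k`.
  even≢odd E (k * t + K + 2 * (k * t) * K + a + 2 * (k * t + K + 2 * (k * t) * K) * a + n * k) (begin
    2 * E                                        ≡⟨ sum-wd k<n w ⟨
    sumFin (wd w)                                ≡⟨ sumFin-cong (wd≡rank k<n w range irr) ⟩
    sumFin (λ v → k * 2 + toℕ (π v))             ≡⟨ sumFin-+ (λ _ → k * 2) (toℕ ∘ π) ⟩
    sumFin {n} (λ _ → k * 2) + sumFin (toℕ ∘ π)  ≡⟨ cong₂ _+_ (sumFin-const n (k * 2)) (sumFin-permute toℕ π π⁻¹ π∘π⁻¹ π⁻¹∘π) ⟩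
    n * (k * 2) + sumFin {n} toℕ                 ≡⟨ cong (n * (k * 2) +_) (trans (sumFin-toℕ n (λ i → i)) total) ⟩
    n * (k * 2) + n * k * t                      ≡⟨ odd (k * t) K a n≡ ⟩
    suc (2 * (k * t + K + 2 * (k * t) * K + a + 2 * (k * t + K + 2 * (k * t) * K) * a + n * k)) ∎)
  where
  k t n E : ℕ
  k = suc (2 * K)
  t = suc (2 * a)
  n = suc (k * (t + t))
  E = sumFin (λ i → sumFin (λ x → w x i))
  π : Fin n → Fin n
  π = rank k<n w range irr
  π-injective : Injective _≡_ _≡_ π
  π-injective = rank-injective k<n w range irr
  π⁻¹ : Fin n → Fin n
  π⁻¹ y = proj₁ (injective⇒surjective π-injective y)
  π∘π⁻¹ : ∀ y → π (π⁻¹ y) ≡ y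
  π∘π⁻¹ y = proj₂ (injective⇒surjective π-injective y)
  π⁻¹∘π : ∀ x → π⁻¹ (π x) ≡ x
  π⁻¹∘π x = π-injective (π∘π⁻¹ (π x))
  n≡ : n ≡ suc (2 * (k * t))
  n≡ = cong suc (double k t)
    where
    double : ∀ k t → k * (t + t) ≡ 2 * (k * t)
    double = solve-∀
  total : ∑ n (λ i → i) ≡ n * k * t
  total = *-cancelˡ-≡ _ _ 2 (+-cancelʳ-≡ n _ _ (trans (sum-below n) (expand n k t refl)))
    where
    expand′ : ∀ m k t → m * suc (k * (t + t)) ≡ 2 * (m * k * t) + m
    expand′ = solve-∀
    expand : ∀ m k t → m ≡ suc (k * (t + t)) → m * m ≡ 2 * (m * k * t) + m
    expand m k t e = trans (cong (m *_) e) (expand′ m k t)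
  odd : ∀ {m} N K a → m ≡ suc (2 * N) → m * (suc (2 * K) * 2) + m * suc (2 * K) * suc (2 * a)
        ≡ suc (2 * (N + K + 2 * N * K + a + 2 * (N + K + 2 * N * K) * a + m * suc (2 * K)))
  odd N K a refl = expand N K a
    where
    expand : ∀ N K a → suc (2 * N) * (suc (2 * K) * 2) + suc (2 * N) * suc (2 * K) * suc (2 * a)
      ≡ suc (2 * (N + K + 2 * N * K + a + 2 * (N + K + 2 * N * K) * a + suc (2 * N) * suc (2 * K)))
    expand = solve-∀

Adjacent : ∀ {n} → ℕ → Fin n → Fin n → Set
Adjacent k u v = Σ[ i ∈ Fin k ] v ≡ shift u (suc (toℕ i))

shift-to : ∀ {n} .⦃ _ : NonZero n ⦄ (u v : Fin n) {d} → toℕ u + d ≡ toℕ v → v ≡ shift u d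
shift-to {n} u v {d} e = Fin.toℕ-injective (sym
  (trans (toℕ-shift u d) (trans (cong (_% n) e) (m<n⇒m%n≡m (Fin.toℕ<n v)))))

-- The distances from `u` to `v` in the two directions add up to `2k + 1`, so one of them is at most
-- `k`.
adjacent-< : ∀ {n k} .⦃ _ : NonZero n ⦄ → n ≡ suc (k * 2) → (u v : Fin n) → toℕ u < toℕ v →
             Adjacent k u v ⊎ Adjacent k v u
adjacent-< {n} {k} n≡ u v u<v with toℕ v ∸ suc (toℕ u) <? k
... | yes e<k = inj₁ (fromℕ< e<k , trans (shift-to u v u+d≡v)
                       (cong (λ y → shift u (suc y)) (sym (Fin.toℕ-fromℕ< e<k))))
  where
  u+d≡v : toℕ u + suc (toℕ v ∸ suc (toℕ u)) ≡ toℕ v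
  u+d≡v = trans (+-suc (toℕ u) _) (m+[n∸m]≡n u<v)
... | no  e≮k = inj₂ (fromℕ< f<k , (begin
    u                                          ≡⟨ shift-shift u d+f≡n ⟨
    shift (shift u d) (suc f)                  ≡⟨ cong (λ y → shift y (suc f)) (shift-to u v u+d≡v) ⟨
    shift v (suc f)                            ≡⟨ cong (λ y → shift v (suc y)) (Fin.toℕ-fromℕ< f<k) ⟨
    shift v (suc (toℕ (fromℕ< f<k)))           ∎))
  where
  d f : ℕ
  d = suc (toℕ v ∸ suc (toℕ u))
  f = n ∸ suc d
  u+d≡v : toℕ u + d ≡ toℕ v
  u+d≡v = trans (+-suc (toℕ u) _) (m+[n∸m]≡n u<v)
  d<n : d < n
  d<n = ≤-trans (s≤s (≤-trans (m≤n+m d (toℕ u)) (≤-reflexive u+d≡v))) (Fin.toℕ<n v)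
  d+f≡n : d + suc f ≡ n
  d+f≡n = trans (+-suc d f) (m+[n∸m]≡n d<n)
  f<k : f < k
  f<k = +-cancelˡ-≤ d (suc f) k (≤-trans (≤-reflexive (trans d+f≡n (trans n≡
          (cong suc (trans (*-comm k 2) (cong (k +_) (+-identityʳ k))))))) (+-monoˡ-≤ k (s≤s (≮⇒≥ e≮k))))

complete : ∀ {n k} .⦃ _ : NonZero n ⦄ → n ≡ suc (k * 2) → (u v : Fin n) → u ≢ v →
           Adjacent k u v ⊎ Adjacent k v u
complete n≡ u v u≢v with <-cmp (toℕ u) (toℕ v)
... | tri< u<v _ _ = adjacent-< n≡ u v u<v
... | tri≈ _ e _   = contradiction (Fin.toℕ-injective e) u≢v
... | tri> _ _ v<u = swap (adjacent-< n≡ v u v<u)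

-- All `2k + 1` values from `2k` to `4k` must occur, so some `u` sees only labels 1 and some `v`
-- only labels 2; the edge joining them would need both.
complete-impossible : ∀ {n k} .⦃ _ : NonZero n ⦄ → 1 ≤ k → n ≡ suc (k * 2) → k < n →
  (w : Labelling n k) → InRange 2 w → ¬ Irregular w
complete-impossible {_} {k} 1≤k refl k<n w range irr =
  clash (complete {n} refl u v u≢v)
  where
  n : ℕ
  n = suc (k * 2)
  π : Fin n → Fin n
  π = rank k<n w range irr
  preimage : ∀ y → ∃[ x ] π x ≡ y
  preimage = injective⇒surjective (rank-injective k<n w range irr)
  top : Fin n
  top = Fin.fromℕ (k * 2)
  u v : Fin n
  u = proj₁ (preimage Fin.zero)
  v = proj₁ (preimage top)
  rank-u : toℕ (π u) ≡ 0
  rank-u = cong toℕ (proj₂ (preimage Fin.zero))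
  rank-v : toℕ (π v) ≡ k * 2
  rank-v = trans (cong toℕ (proj₂ (preimage top))) (Fin.toℕ-fromℕ (k * 2))
  u≢v : u ≢ v
  u≢v e = <⇒≢ (≤-trans 1≤k (m≤m*n k 2)) (trans (sym rank-u) (trans (cong (toℕ ∘ π) e) rank-v))

  edges-u : ∀ i → edges w u i ≤ 2
  edges-u = sumFin-squeeze (λ i → +-mono-≤ (proj₁ (range u i)) (proj₁ (range _ i)))
    (≤-reflexive (begin
      sumFin (edges w u)       ≡⟨ wd≡ k<n w u ⟨
      wd w u                   ≡⟨ wd≡rank k<n w range irr u ⟩
      k * 2 + toℕ (π u)        ≡⟨ cong (k * 2 +_) rank-u ⟩
      k * 2 + 0                ≡⟨ +-identityʳ (k * 2) ⟩
      k * 2                    ≡⟨ sumFin-const k 2 ⟨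
      sumFin {k} (λ _ → 2)     ∎))

  edges-v : ∀ i → 4 ≤ edges w v i
  edges-v = sumFin-squeeze (edges≤ k<n w range irr v)
    (≤-reflexive (begin
      sumFin {k} (λ _ → 4)     ≡⟨ sumFin-const k 4 ⟩
      k * 4                    ≡⟨ *-distribˡ-+ k 2 2 ⟩
      k * 2 + k * 2            ≡⟨ cong (k * 2 +_) rank-v ⟨
      k * 2 + toℕ (π v)        ≡⟨ wd≡rank k<n w range irr v ⟨
      wd w v                   ≡⟨ wd≡ k<n w v ⟩
      sumFin (edges w v)       ∎))

  out-u : ∀ i → w u i ≤ 1
  out-u i = +-cancelʳ-≤ 1 _ _ (≤-trans (+-monoʳ-≤ (w u i) (proj₁ (range _ i))) (edges-u i))
  in-u : ∀ i → w (back u (suc (toℕ i))) i ≤ 1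
  in-u i = +-cancelˡ-≤ 1 _ _ (≤-trans (+-monoˡ-≤ _ (proj₁ (range u i))) (edges-u i))
  out-v : ∀ i → 2 ≤ w v i
  out-v i = +-cancelʳ-≤ 2 _ _ (≤-trans (edges-v i) (+-monoʳ-≤ (w v i) (proj₂ (range _ i))))
  in-v : ∀ i → 2 ≤ w (back v (suc (toℕ i))) i
  in-v i = +-cancelˡ-≤ 2 _ _ (≤-trans (edges-v i) (+-monoˡ-≤ _ (proj₂ (range v i))))

  back≡ : ∀ {x y : Fin n} {i : Fin k} → y ≡ shift x (suc (toℕ i)) → back y (suc (toℕ i)) ≡ x
  back≡ {x} {i = i} refl = back-shift x (≤-trans (Fin.toℕ<n i) (<⇒≤ k<n))

  clash : ¬ (Adjacent k u v ⊎ Adjacent k v u)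
  clash (inj₁ (i , e)) = contradiction
    (≤-trans (in-v i) (subst (λ x → w x i ≤ 1) (sym (back≡ e)) (out-u i))) λ { (s≤s ()) }
  clash (inj₂ (i , e)) = contradiction
    (≤-trans (subst (λ x → 2 ≤ w x i) (sym (back≡ e)) (out-v i)) (in-u i)) λ { (s≤s ()) }

-- Irregular paths of the required sizes.

halves : ∀ p → ∃[ X ] ∃[ Y ] X + Y ≡ p × X ≤ suc Y × Y ≤ X
halves p = ⌈ p /2⌉ , ⌊ p /2⌋ , trans (+-comm ⌈ p /2⌉ ⌊ p /2⌋) (⌊n/2⌋+⌈n/2⌉≡n p)
  , ⌈n/2⌉≤1+⌊n/2⌋ p , ⌊n/2⌋≤⌈n/2⌉ p
  where
  ⌈n/2⌉≤1+⌊n/2⌋ : ∀ n → ⌈ n /2⌉ ≤ suc ⌊ n /2⌋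
  ⌈n/2⌉≤1+⌊n/2⌋ zero          = z≤n
  ⌈n/2⌉≤1+⌊n/2⌋ (suc zero)    = ≤-refl
  ⌈n/2⌉≤1+⌊n/2⌋ (suc (suc n)) = s≤s (⌈n/2⌉≤1+⌊n/2⌋ n)

m+m≤n+n⇒m≤n : ∀ {m n} → m + m ≤ n + n → m ≤ n
m+m≤n+n⇒m≤n le = ≮⇒≥ (λ n<m → <⇒≱ (+-mono-< n<m n<m) le)

-- The halves of `p ≤ 2 * k` are at most `k`, so the antiregular graph on `p` vertices fits into the
-- `k`-th power of a path.
irregular-base : ∀ {k p} → 1 ≤ k → 1 ≤ p → p ≤ 2 * k →
            IrregularPath k 2 (k + p + k) × AlmostIrregularPath k 2 (k + p)
irregular-base {k} {p} 1≤k 1≤p p≤2k with X , Y , refl , X≤1+Y , Y≤X ← halves p =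
  capped-irregular 1≤k 1≤X X≤k X≤1+Y Y≤X , capped-almostIrregularPath 1≤k 1≤X X≤k X≤1+Y Y≤X
  where
  1≤X : 1 ≤ X
  1≤X = ≮⇒≥ λ { (s≤s z≤n) → contradiction (≤-trans 1≤p Y≤X) λ () }
  X≤k : X ≤ k
  X≤k with X ≟ suc Y
  ... | yes refl = ≮⇒≥ λ k<X → <⇒≱ (s≤s (+-mono-≤ (≤-pred k<X) (≤-pred k<X)))
                     (≤-trans p≤2k (≤-reflexive (cong (k +_) (+-identityʳ k))))
  ... | no  X≢   = m+m≤n+n⇒m≤n (≤-trans (+-monoʳ-≤ X (≤-pred (≤∧≢⇒< X≤1+Y X≢)))
                     (≤-trans p≤2k (≤-reflexive (cong (k +_) (+-identityʳ k)))))

even-or-odd : ∀ b → ∃[ j ] (b ≡ j * 2 ⊎ b ≡ suc (j * 2))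
even-or-odd zero = 0 , inj₁ refl
even-or-odd (suc b) with even-or-odd b
... | j , inj₁ refl = j , inj₂ refl
... | j , inj₂ refl = suc j , inj₁ refl

irregular-cast : ∀ {k s N s′ N′} → s ≡ s′ → N ≡ N′ → IrregularPath k s N → IrregularPath k s′ N′
irregular-cast refl refl g = g

-- A round of two layers adds 2 to `b`, so its parity selects the start: the capped path for odd
-- `b`, a further layer around its almost irregular version for even `b`.
irregular-loose : ∀ {k p} b → 1 ≤ k → 1 ≤ p → p ≤ 2 * k → 1 ≤ b → IrregularPath k (suc b) (p + b * (2 * k))
irregular-loose {k} {p} b 1≤k 1≤p p≤2k 1≤b with even-or-odd b
... | zero  , inj₁ refl = contradiction 1≤b λ ()
... | suc j , inj₁ refl = irregular-cast (+-comm (j * 2) 3) (size k p j)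
      (irregular-iterate 1≤k (wrap-almostIrregular 1≤k (proj₂ (irregular-base 1≤k 1≤p p≤2k))) j)
  where
  size : ∀ k p j → j * (4 * k) + (k + (k + p + k) + k) ≡ p + (suc j * 2) * (2 * k)
  size = solve-∀
... | j , inj₂ refl = irregular-cast (+-comm (j * 2) 2) (size k p j)
      (irregular-iterate 1≤k (proj₁ (irregular-base 1≤k 1≤p p≤2k)) j)
  where
  size : ∀ k p j → j * (4 * k) + (k + p + k) ≡ p + suc (j * 2) * (2 * k)
  size = solve-∀

-- With labels up to `q = j * 2` the degrees lie between 0 and `q * (2 * k)`; rounds around a single
-- vertex use up all these values.
irregular-tight-even : ∀ {k} j → 1 ≤ k → IrregularPath k (j * 2) (1 + (j * 2) * (2 * k))
irregular-tight-even {k} j 1≤k =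
  irregular-cast (+-identityʳ (j * 2)) (size k j) (irregular-iterate 1≤k (irregular-one k) j)
  where
  size : ∀ k j → j * (4 * k) + 1 ≡ 1 + (j * 2) * (2 * k)
  size = solve-∀

-- The `4k + 1` vertices available for even `k` and one more layer give `6k + 1`, the case `q = 3`;
-- rounds do the rest.
irregular-tight-odd : ∀ {m} j → 1 ≤ m → let k = m + m; q = suc (suc j * 2) in IrregularPath k q (1 + q * (2 * k))
irregular-tight-odd {m} j 1≤m = irregular-cast (+-comm (j * 2) 3) (size k j)
  (irregular-iterate 1≤k (wrap-almostIrregular {N = k + (k + 1 + k)} 1≤k (almostIrregularPath-even 1≤m)) j)
  where
  k : ℕ
  k = m + m
  1≤k : 1 ≤ k
  1≤k = ≤-trans 1≤m (m≤m+n m m)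
  size : ∀ k j → j * (4 * k) + (k + (k + (k + 1 + k) + k) + k) ≡ 1 + suc (suc j * 2) * (2 * k)
  size = solve-∀

-- Arithmetic of the formula and of the exceptional cases.

-- The dividend `(n + 2k - 1) + (2k - 1)` equals `(n - 2) + 2 * 2k`, so the value is 2 plus the
-- quotient of `n - 2` by `2k`.
baseValue≡ : ∀ {n k r} b → 1 ≤ k → r < 2 * k → n ≡ 2 + r + b * (2 * k) → baseValue n k ≡ 2 + b
baseValue≡ {_} {k@(suc j)} {r} b _ r<c refl = begin
  (1 + (r + b * c) + c + (c ∸ 1)) / c   ≡⟨ cong (_/ c) (rearrange r (b * c) (c ∸ 1)) ⟩
  (r + (2 + b) * c) / c                 ≡⟨ +-distrib-/-∣ʳ r (n∣m*n (2 + b)) ⟩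
  r / c + (2 + b) * c / c               ≡⟨ cong₂ _+_ (m<n⇒m/n≡0 r<c) (m*n/n≡m (2 + b) c) ⟩
  2 + b                                 ∎
  where
  c : ℕ
  c = 2 * suc j
  rearrange : ∀ r x y → 1 + (r + x) + suc y + y ≡ r + (suc y + (suc y + x))
  rearrange = solve-∀

decompose : ∀ n c .⦃ _ : NonZero c ⦄ → 2 ≤ n → ∃[ b ] ∃[ r ] r < c × n ≡ 2 + r + b * c
decompose n c 2≤n = (n ∸ 2) / c , (n ∸ 2) % c , m%n<n (n ∸ 2) c
  , trans (sym (m+[n∸m]≡n 2≤n)) (cong (2 +_) (m≡m%n+[m/n]*n (n ∸ 2) c))

-- n = 1 + (2a + 1) 2k, so that n weighted degrees exhaust [2k , 2k(2a + 2)].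
OddTight : ℕ → ℕ → ℕ → Set
OddTight n k a = n ≡ suc (suc (2 * a) * (2 * k))

-- Both cases are tight, with `a = n / (4 * k)` and `a = 0`; the disjunction records the
-- obstruction, parity or the complete graph.
exceptional⇒ : ∀ {n k} → 1 ≤ k → Exceptional n k →
               ∃[ a ] OddTight n k a × (∃[ K ] k ≡ suc (2 * K) ⊎ a ≡ 0)
exceptional⇒ {n} {k@(suc j)} _ (inj₁ (n%4k , k%2)) = n / (4 * k)
  , trans (m≡m%n+[m/n]*n n (4 * k)) (trans (cong (_+ n / (4 * k) * (4 * k)) n%4k) (size k (n / (4 * k))))
  , inj₁ (k / 2 , trans (m≡m%n+[m/n]*n k 2) (cong₂ _+_ k%2 (*-comm (k / 2) 2)))
  where
  size : ∀ k a → 2 * k + 1 + a * (4 * k) ≡ suc (suc (2 * a) * (2 * k))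
  size = solve-∀
exceptional⇒ {n} {k@(suc j)} _ (inj₂ e) =
  0 , trans e (trans (+-comm (2 * k) 1) (cong suc (sym (*-identityˡ (2 * k))))) , inj₂ refl

-- Tightness forces `n % (4 * k) ≡ 2 * k + 1`, so an odd `k` would be exceptional, and so would
-- `a = 0`, where `n = 2k + 1`.
unexceptional⇒ : ∀ {n k} a → 2 ≤ k → ¬ Exceptional n k → OddTight n k a →
                 (∃[ m ] k ≡ m + m) × 1 ≤ a
unexceptional⇒ {n} {k@(suc j)} a 2≤k ¬exc tight = even , positive a tight
  where
  positive : ∀ a → OddTight n k a → 1 ≤ a
  positive (suc a) _ = z<s
  positive zero    e = contradiction
    (inj₂ (trans e (trans (cong suc (*-identityˡ (2 * k))) (+-comm 1 (2 * k))))) ¬exc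
  n%4k : n % (4 * k) ≡ 2 * k + 1
  n%4k = begin
    n % (4 * k)                            ≡⟨ cong (_% (4 * k)) (trans tight (size k a)) ⟩
    (2 * k + 1 + a * (4 * k)) % (4 * k)    ≡⟨ [m+kn]%n≡m%n (2 * k + 1) a (4 * k) ⟩
    (2 * k + 1) % (4 * k)                  ≡⟨ m<n⇒m%n≡m small ⟩
    2 * k + 1                              ∎
    where
    size : ∀ k a → suc (suc (2 * a) * (2 * k)) ≡ 2 * k + 1 + a * (4 * k)
    size = solve-∀
    double : ∀ k → 2 * k + 2 * k ≡ 4 * k
    double = solve-∀
    small : 2 * k + 1 < 4 * k
    small = subst (2 * k + 1 <_) (double k) (+-monoʳ-< (2 * k) (≤-trans 2≤k (m≤m+n k (k + 0))))
  even : ∃[ m ] k ≡ m + m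
  even with even-or-odd k
  ... | m , inj₁ e = m , trans e (trans (*-comm m 2) (cong (m +_) (+-identityʳ m)))
  ... | m , inj₂ e = contradiction
    (inj₁ (n%4k , trans (cong (_% 2) e) ([m+kn]%n≡m%n 1 m 2))) ¬exc

-- The loose construction with `p = 2 + r` applies unless `r = 2k - 1`; then `n = 1 + (b + 1) * 2k`
-- is tight and the parity of `b` decides.
irregular-unexceptional : ∀ {n k r} b → 2 ≤ k → 2 * k + 1 ≤ n → r < 2 * k → n ≡ 2 + r + b * (2 * k) →
                     ¬ Exceptional n k → IrregularPath k (suc b) n
irregular-unexceptional {n} {k} {r} b 2≤k 2k<n r<2k n≡ ¬exc with 2 + r ≤? 2 * k
... | yes p≤2k = irregular-cast refl (sym n≡) (irregular-loose b (<⇒≤ 2≤k) z<s p≤2k (positive b n≡))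
  where
  positive : ∀ b → n ≡ 2 + r + b * (2 * k) → 1 ≤ b
  positive (suc b) _ = z<s
  positive zero    e = contradiction
    (≤-trans 2k<n (≤-trans (≤-reflexive (trans e (+-identityʳ (2 + r)))) p≤2k))
    (λ le → <⇒≱ (m<m+n (2 * k) z<s) le)
... | no p≰2k = tight-case (even-or-odd b)
  where
  suc-r≡2k : suc r ≡ 2 * k
  suc-r≡2k = ≤-antisym r<2k (≤-pred (≰⇒> p≰2k))
  n≡1+q2k : n ≡ 1 + suc b * (2 * k)
  n≡1+q2k = trans n≡ (cong (λ c → suc (c + b * (2 * k))) suc-r≡2k)
  tight-case : ∃[ j ] (b ≡ j * 2 ⊎ b ≡ suc (j * 2)) → IrregularPath k (suc b) n
  tight-case (j , inj₂ refl) = irregular-cast refl (sym n≡1+q2k) (irregular-tight-even (suc j) (<⇒≤ 2≤k))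
  tight-case (a , inj₁ refl)
    with unexceptional⇒ a 2≤k ¬exc (trans n≡1+q2k (cong (λ c → suc (suc c * (2 * k))) (*-comm a 2)))
  ... | (suc m , refl) , s≤s {n = j} _ = irregular-cast refl (sym n≡1+q2k) (irregular-tight-odd j z<s)
  ... | (zero , refl) , _ = contradiction 2≤k λ ()

-- Lower bounds on the number of labels, and the strength.

-- Labels up to `suc t` permit only `1 + t * (2 * k)` weighted degrees, so a larger `n` forces a
-- larger label.
labels-≥ : ∀ {n k} b .⦃ _ : NonZero n ⦄ → 1 ≤ k → k < n → suc (b * (2 * k)) < n →
           ∀ t → HasIrregularLabelling n k t → 2 + b ≤ t
labels-≥ {suc n} {k} b 1≤k k<n large zero (w , range , _) =
  contradiction (≤-trans (proj₁ (range Fin.zero (fromℕ< 1≤k))) (proj₂ (range Fin.zero (fromℕ< 1≤k)))) λ ()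
labels-≥ {n} {k} b 1≤k k<n large (suc t) (w , range , irr) = s≤s (≰⇒> λ t≤b →
  <⇒≱ large (≤-trans (n≤range k<n w range irr)
    (s≤s (≤-trans (≤-reflexive (size k t)) (*-monoˡ-≤ (2 * k) t≤b)))))
  where
  size : ∀ k t → k * (t + t) ≡ t * (2 * k)
  size = solve-∀

-- Counting alone still allows the bound `2 + 2 * a`; parity or the complete graph excludes it.
labels-≢ : ∀ {n k} a .⦃ _ : NonZero n ⦄ → 1 ≤ k → k < n → OddTight n k a →
           ∃[ K ] k ≡ suc (2 * K) ⊎ a ≡ 0 → ¬ HasIrregularLabelling n k (2 + 2 * a)
labels-≢ {n} {k} a 1≤k k<n tight (inj₁ (K , refl)) (w , range , irr) =
  odd-tight-impossible K a (trans tight (cong suc (size (suc (2 * K)) (suc (2 * a))))) k<n w range irr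
  where
  size : ∀ k t → t * (2 * k) ≡ k * (t + t)
  size = solve-∀
labels-≢ {n} {k} .0 1≤k k<n tight (inj₂ refl) (w , range , irr) =
  complete-impossible 1≤k (trans tight (cong suc (size k))) k<n w range irr
  where
  size : ∀ k → 1 * (2 * k) ≡ k * 2
  size = solve-∀

k<2k+1 : ∀ {n k} → 2 * k + 1 ≤ n → k < n
k<2k+1 {n} {k} le = ≤-trans (≤-trans (s≤s (m≤m+n k (k + 0))) (≤-reflexive (+-comm 1 (2 * k)))) le

theorem1p3 : (n k : ℕ) → 2 ≤ k → 2 * k + 1 ≤ n →
    (Exceptional n k → IrregularityStrength n k (baseValue n k + 1)) ×
    (¬ Exceptional n k → IrregularityStrength n k (baseValue n k))
theorem1p3 n k 2≤k 2k<n = exceptional , unexceptional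
  where
  1≤k : 1 ≤ k
  1≤k = <⇒≤ 2≤k
  k<n : k < n
  k<n = k<2k+1 2k<n
  instance
    n≢0 : NonZero n
    n≢0 = >-nonZero (≤-trans z<s k<n)
    2k≢0 : NonZero (2 * k)
    2k≢0 = >-nonZero (≤-trans 1≤k (m≤m+n k (k + 0)))

  exceptional : Exceptional n k → IrregularityStrength n k (baseValue n k + 1)
  exceptional exc with a , tight , why ← exceptional⇒ 1≤k exc =
    subst (IrregularityStrength n k) (sym (trans (+-comm (baseValue n k) 1) (cong suc base)))
      -- Treated as the loose case with `p = 1` and `b = suc (2 * a)`, a tight `n` costs exactly one
      -- extra label.
      ( irregular⇒labelling k<n (irregular-cast refl (sym tight)
          (irregular-loose (suc (2 * a)) 1≤k ≤-refl (≤-trans 1≤k (m≤m+n k (k + 0))) z<s))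
      , λ t lab → ≤∧≢⇒< (labels-≥ (2 * a) 1≤k k<n large t lab)
          (λ { refl → labels-≢ a 1≤k k<n tight why lab }))
    where
    c : ℕ
    c = 2 * k
    2≤c : 2 ≤ c
    2≤c = ≤-trans 2≤k (m≤m+n k (k + 0))
    base : baseValue n k ≡ 2 + 2 * a
    -- A tight `n` is the case `r = 2k - 1`.
    base = baseValue≡ (2 * a) 1≤k (∸-monoʳ-< {c} {1} {0} z<s (≤-trans 1≤k (m≤m+n k (k + 0))))
      (trans tight (cong suc (cong (_+ 2 * a * c) (sym (m+[n∸m]≡n {1} {c} (<⇒≤ 2≤c))))))
    large : suc (2 * a * c) < n
    large = ≤-trans (s≤s (+-monoˡ-≤ (2 * a * c) (<⇒≤ 2≤c))) (≤-reflexive (sym tight))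

  unexceptional : ¬ Exceptional n k → IrregularityStrength n k (baseValue n k)
  unexceptional ¬exc
    with b , r , r<2k , n≡ ← decompose n (2 * k) (≤-trans (≤-trans 2≤k (m≤m+n k (k + 0))) (≤-trans (m≤m+n (2 * k) 1) 2k<n)) =
    subst (IrregularityStrength n k) (sym (baseValue≡ b 1≤k r<2k n≡))
      ( irregular⇒labelling k<n (irregular-unexceptional b 2≤k 2k<n r<2k n≡ ¬exc)
      , labels-≥ b 1≤k k<n (≤-trans (s≤s (s≤s (m≤n+m (b * (2 * k)) r))) (≤-reflexive (sym n≡))))
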